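{- Let $D$ be a strongly connected digraph and $k$ a positive integer. Then either $\ell_s(D)\ge k$ or the underlying undirected graph of $D$ is of pathwidth $O(k\log k)$; that is, there is an absolute constant $C$ such that for every positive integer $k$ and every strongly connected digraph $D$, either $\ell_s(D)\ge k$ or $pw(UN(D))\le C\,k\log k$.
   Context: Digraphs are finite, with no loops and no parallel arcs (directed 2-cycles are allowed). A digraph is strongly connected if for every pair $x,y$ of vertices there are directed paths from $x$ to $y$ and from $y$ to $x$. The underlying undirected graph $UN(D)$ of $D$ is obtained from $D$ by omitting all orientations of arcs and deleting one edge from each resulting pair of parallel edges. A subdigraph $T$ of a digraph $D$ is an out-tree if $T$ is an oriented tree with only one vertex of in-degree zero (called the root); if moreover $V(T)=V(D)$, then $T$ is called an out-branching of $D$. The leaves of $T$ are its vertices of out-degree zero in $T$. $\ell_s(D)$ denotes the maximum possible number of leaves in an out-branching of $D$, with $\ell_s(D)=0$ if $D$ has no out-branching. A path decomposition of an undirected graph $G$ is a pair $(X,U)$ where $U$ is a path and $X=\{X_i\mid i\in V(U)\}$ is a collection of subsets of $V(G)$ such that $\bigcup_i X_i=V(G)$, every edge $\{v,w\}$ of $G$ has $v,w\in X_i$ for some $i$, and for each $v\in V(G)$ the set $\{i\mid v\in X_i\}$ forms a subpath of $U$. Its width is $\max_i(|X_i|-1)$, and the pathwidth $pw(G)$ is the minimum width over all path decompositions of $G$. -}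

module Defs where

open import Data.Empty using (⊥-elim)
open import Data.Fin.Base as Fin using (Fin; zero; suc; toℕ; fromℕ<; inject₁; punchIn; punchOut)
open import Data.Fin.Properties as Fin using (any?; all?)
open import Data.Fin.Subset using (Subset; _∈_; _∉_; _⊆_; ∣_∣; ⊤)
open import Data.Fin.Subset.Properties using (_∈?_; _⊆?_; anySubset?; ∈⊤)
open import Data.List.Base as List using (length; filter; allFin)
open import Data.List.Properties using (length-filter; length-tabulate)
open import Data.Nat.Base
open import Data.Nat.Properties
open import Data.Product.Base using (Σ; ∃; ∃-syntax; _×_; _,_; proj₁; proj₂)
open import Data.Sum.Base as Sum using (_⊎_; inj₁; inj₂; swap)
open import Data.Vec.Base as Vec using (Vec; []; _∷_; lookup; tabulate; last)
open import Data.Vec.Properties using (lookup∘tabulate)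
open import Data.Vec.Relation.Unary.AllPairs using (allPairs?)
open import Data.Vec.Relation.Unary.Linked using (Linked; linked?)
open import Data.Vec.Relation.Unary.Unique.Propositional using (Unique)
open import Data.Vec.Relation.Unary.Unique.Propositional.Properties using (lookup-injective)
open import Function.Base using (_∘_; id)
open import Level using (0ℓ)
open import Relation.Binary.Core using (Rel)
open import Relation.Binary.Definitions using (Symmetric; Irreflexive; Decidable; tri<; tri≈; tri>)
open import Relation.Binary.Construct.Closure.ReflexiveTransitive using (Star; ε; _◅_; _◅◅_)
open import Relation.Binary.PropositionalEquality
open import Relation.Nullary using (Dec; yes; no; ¬_)
open import Relation.Nullary.Decidable using (map′; ¬?; _×-dec_; _⊎-dec_; _→-dec_; decidable-stable)
import Relation.Unary as U

private
  variable
    m n : ℕ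

------------------------------------------------------------------------
-- Undirected graphs

record Graph (n : ℕ) : Set₁ where
  field
    _~_    : Rel (Fin n) 0ℓ
    ~-sym  : Symmetric _~_
    ~-irr  : Irreflexive _≡_ _~_
    _~?_   : Decidable _~_

  Connected : Set
  Connected = ∀ u v → Star _~_ u v

  -- A cycle lists at least three distinct vertices; the closing edge
  -- joins the last of them to the first.
  Cycle : Set
  Cycle = ∃[ m ] Σ (Vec (Fin n) (3 + m)) λ c → Unique c × Linked _~_ (last c ∷ c)

  IsTree : Set
  IsTree = Connected × ¬ Cycle

------------------------------------------------------------------------
-- Digraphs

-- Vertex u has an arc to v when v belongs to the u-th entry of out.
record Digraph (n : ℕ) : Set where
  field
    out      : Vec (Subset n) n
    loopless : ∀ v → v ∉ lookup out v

  infix 4 _⟶_ _⟶?_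

  _⟶_ : Rel (Fin n) 0ℓ
  u ⟶ v = v ∈ lookup out u

  _⟶?_ : Decidable _⟶_
  u ⟶? v = v ∈? lookup out u

  outDegree : Fin n → ℕ
  outDegree u = ∣ lookup out u ∣

  inDegree : Fin n → ℕ
  inDegree v = length (filter (_⟶? v) (allFin n))

  leaves : ℕ
  leaves = length (filter (λ v → outDegree v ≟ 0) (allFin n))

  StronglyConnected : Set
  StronglyConnected = ∀ x y → Star _⟶_ x y

  Oriented : Set
  Oriented = ∀ u v → ¬ (u ⟶ v × v ⟶ u)

open Digraph public using (leaves; StronglyConnected)

UN : Digraph n → Graph n
UN D = record
  { _~_   = λ u v → u ⟶ v ⊎ v ⟶ u
  ; ~-sym = swap
  ; ~-irr = λ { refl → Sum.[ loopless _ , loopless _ ] }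
  ; _~?_  = λ u v → (u ⟶? v) ⊎-dec (v ⟶? u)
  }
  where open Digraph D

------------------------------------------------------------------------
-- Out-branchings

-- T has the same vertex set as D, so an out-tree T contained in D is
-- automatically spanning.
record IsOutBranching (D T : Digraph n) : Set where
  private
    module D = Digraph D
    module T = Digraph T
  field
    subdigraph : ∀ u v → u T.⟶ v → u D.⟶ v
    oriented   : T.Oriented
    tree       : Graph.IsTree (UN T)
    root       : Fin n
    root-in    : T.inDegree root ≡ 0
    root-uniq  : ∀ v → T.inDegree v ≡ 0 → v ≡ root

OutBranching : Digraph n → Set
OutBranching D = ∃ (IsOutBranching D)

IsLeafNumber : Digraph n → ℕ → Set
IsLeafNumber D m =
    (∀ ((T , _) : OutBranching D) → leaves T ≤ m)
  × ((∃ λ ((T , _) : OutBranching D) → leaves T ≡ m) ⊎ (¬ OutBranching D × m ≡ 0))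

------------------------------------------------------------------------
-- Path decompositions

-- Truncated subtraction matters only when every bag is empty; in a path
-- decomposition that forces the graph to be empty.
bagsWidth : Vec (Subset n) m → ℕ
bagsWidth = Vec.foldr (λ _ → ℕ) (λ X w → (∣ X ∣ ∸ 1) ⊔ w) 0

-- The path is 0 — 1 — ⋯ — p, so its subpaths are the nonempty intervals.
record PathDecomposition (G : Graph n) : Set where
  open Graph G
  field
    p        : ℕ
    bags     : Vec (Subset n) (suc p)

  bag : Fin (suc p) → Subset n
  bag = lookup bags

  field
    covers   : ∀ v → ∃[ i ] v ∈ bag i
    edges    : ∀ u v → u ~ v → ∃[ i ] (u ∈ bag i × v ∈ bag i)
    interval : ∀ v {i j k} → i Fin.≤ j → j Fin.≤ k → v ∈ bag i → v ∈ bag k → v ∈ bag j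

  width : ℕ
  width = bagsWidth bags

open PathDecomposition public using (width)

IsPathwidth : Graph n → ℕ → Set
IsPathwidth G w =
    (∀ (P : PathDecomposition G) → w ≤ width P)
  × (∃ λ (P : PathDecomposition G) → width P ≡ w)

------------------------------------------------------------------------
-- Deciding existence of out-branchings

-- Reachability, by allowing one more intermediate vertex at a time.
module Reachability {R : Rel (Fin n) 0ℓ} (R? : Decidable R) where

  Via : ℕ → Rel (Fin n) 0ℓ
  Via zero    x y = x ≡ y ⊎ R x y
  Via (suc m) x y = Via m x y ⊎ ∃[ z ] (toℕ z ≡ m × Via m x z × Via m z y)

  via? : ∀ m → Decidable (Via m)
  via? zero    x y = (x Fin.≟ y) ⊎-dec R? x y
  via? (suc m) x y = via? m x y ⊎-dec
    any? (λ z → (toℕ z ≟ m) ×-dec via? m x z ×-dec via? m z y)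

  via⇒star : ∀ m {x y} → Via m x y → Star R x y
  via⇒star zero    (inj₁ refl)              = ε
  via⇒star zero    (inj₂ r)                 = r ◅ ε
  via⇒star (suc m) (inj₁ v)                 = via⇒star m v
  via⇒star (suc m) (inj₂ (_ , _ , v , v′)) = via⇒star m v ◅◅ via⇒star m v′

  lift₀ : ∀ m {x y} → Via 0 x y → Via m x y
  lift₀ zero    v = v
  lift₀ (suc m) v = inj₁ (lift₀ m v)

  via-to : ∀ m {x z} → toℕ z ≡ m → Via (suc m) x z → Via m x z
  via-to m eq (inj₁ v) = v
  via-to m eq (inj₂ (z′ , eq′ , v , _))
    with refl ← Fin.toℕ-injective (trans eq′ (sym eq)) = v

  via-from : ∀ m {z y} → toℕ z ≡ m → Via (suc m) z y → Via m z y
  via-from m eq (inj₁ v) = v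
  via-from m eq (inj₂ (z′ , eq′ , _ , v))
    with refl ← Fin.toℕ-injective (trans eq′ (sym eq)) = v

  via-trans : ∀ m {x z y} → toℕ z < m → Via m x z → Via m z y → Via m x y
  via-trans (suc m) {z = z} z<1+m v v′ with toℕ z ≟ m
  ... | yes eq = inj₂ (z , eq , via-to m eq v , via-from m eq v′)
  ... | no neq = go v v′
    where
    z<m = ≤∧≢⇒< (≤-pred z<1+m) neq
    go : ∀ {x y} → Via (suc m) x z → Via (suc m) z y → Via (suc m) x y
    go (inj₁ a) (inj₁ b) = inj₁ (via-trans m z<m a b)
    go (inj₁ a) (inj₂ (q , e , b , c)) = inj₂ (q , e , via-trans m z<m a b , c)
    go (inj₂ (q , e , a , b)) (inj₁ c) = inj₂ (q , e , a , via-trans m z<m b c)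
    go (inj₂ (q , e , a , _)) (inj₂ (q′ , e′ , _ , d))
      with refl ← Fin.toℕ-injective (trans e (sym e′)) = inj₂ (q , e , a , d)

  star⇒via : ∀ {x y} → Star R x y → Via n x y
  star⇒via ε = lift₀ n (inj₁ refl)
  star⇒via (_◅_ {j = z} r rs) =
    via-trans n (Fin.toℕ<n z) (lift₀ n (inj₂ r)) (star⇒via rs)

  star? : Decidable (Star R)
  star? x y = map′ (via⇒star n) star⇒via (via? n x y)

Searchable : Set → Set₁
Searchable A = ∀ {P : A → Set} → U.Decidable P → Dec (∃ P)

anyVec? : ∀ {A} → Searchable A → Searchable (Vec A m)
anyVec? {m = zero}  any P? = map′ ([] ,_) (λ { ([] , p) → p }) (P? [])
anyVec? {m = suc m} any P? =
  map′ (λ { (x , xs , p) → x ∷ xs , p }) (λ { (x ∷ xs , p) → x , xs , p })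
       (any λ x → anyVec? any λ xs → P? (x ∷ xs))

anyDigraph? : Searchable (Digraph n)
anyDigraph? {n} P? = map′
  (λ { (o , l , q) → record { out = o ; loopless = l } , q })
  (λ { (D , q) → Digraph.out D , Digraph.loopless D , q })
  (anyVec? anySubset? λ o → decide o (all? λ v → ¬? (v ∈? lookup o v)))
  where
  decide : ∀ o → Dec (∀ v → v ∉ lookup o v) → Dec (Σ (∀ v → v ∉ lookup o v) λ l → _)
  decide o (no ¬l) = no (¬l ∘ proj₁)
  decide o (yes l) = map′ (l ,_) proj₂ (P? (record { out = o ; loopless = l }))

≤-any? : ∀ b {P : ℕ → Set} → U.Decidable P → Dec (∃[ m ] (m ≤ b × P m))
≤-any? b {P} P? = map′
  (λ { (i , p) → toℕ i , ≤-pred (Fin.toℕ<n i) , p })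
  (λ { (m , m≤b , p) → fromℕ< (s≤s m≤b) , subst P (sym (Fin.toℕ-fromℕ< (s≤s m≤b))) p })
  (any? {n = suc b} (P? ∘ toℕ))

module _ (G : Graph n) where
  open Graph G

  cycle? : Dec Cycle
  cycle? = map′
    (λ { (m , _ , c) → m , c })
    (λ { (m , c , u , l) → m , short c u , c , u , l })
    (≤-any? n λ m → anyVec? any? λ c →
      allPairs? (λ x y → ¬? (x Fin.≟ y)) c ×-dec linked? _~?_ (last c ∷ c))
    where
    short : ∀ {m} (c : Vec (Fin n) (3 + m)) → Unique c → m ≤ n
    short c u = ≤-trans (m≤n+m _ 3) (Fin.injective⇒≤ (lookup-injective u _ _))

  isTree? : Dec IsTree
  isTree? = (all? λ u → all? λ v → Reachability.star? _~?_ u v) ×-dec ¬? cycle?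

isOutBranching? : (D : Digraph n) → U.Decidable (IsOutBranching D)
isOutBranching? {n} D T = map′ to from
  (     (all? λ u → all? λ v → (u T.⟶? v) →-dec (u D.⟶? v))
  ×-dec (all? λ u → all? λ v → ¬? ((u T.⟶? v) ×-dec (v T.⟶? u)))
  ×-dec isTree? (UN T)
  ×-dec (any? λ r → (T.inDegree r ≟ 0)
           ×-dec (all? λ v → (T.inDegree v ≟ 0) →-dec (v Fin.≟ r))))
  where
  module D = Digraph D
  module T = Digraph T

  Conditions : Set
  Conditions =
      (∀ u v → u T.⟶ v → u D.⟶ v)
    × T.Oriented
    × Graph.IsTree (UN T)
    × (∃[ r ] (T.inDegree r ≡ 0 × (∀ v → T.inDegree v ≡ 0 → v ≡ r)))

  to : Conditions → IsOutBranching D T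
  to (s , o , t , r , ri , ru) = record
    { subdigraph = s ; oriented = o ; tree = t
    ; root = r ; root-in = ri ; root-uniq = ru }

  from : IsOutBranching D T → Conditions
  from B = subdigraph , oriented , tree , root , root-in , root-uniq
    where open IsOutBranching B

leaves≤n : (T : Digraph n) → leaves T ≤ n
leaves≤n {n} T = ≤-trans (length-filter _ (allFin n)) (≤-reflexive (length-tabulate id))

greatest : ∀ b {P : ℕ → Set} → U.Decidable P → (∀ m → P m → m ≤ b) →
           (∃[ m ] (P m × (∀ j → P j → j ≤ m))) ⊎ (∀ m → ¬ P m)
greatest b P? bound with P? b
... | yes p = inj₁ (b , p , bound)
greatest zero {P} P? bound | no ¬p = inj₂ λ m p → ¬p (subst P (n≤0⇒n≡0 (bound m p)) p)
greatest (suc b) P? bound | no ¬p =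
  greatest b P? λ m p → ≤-pred (≤∧≢⇒< (bound m p) λ { refl → ¬p p })

abstract
  leafNumber : (D : Digraph n) → ∃ (IsLeafNumber D)
  leafNumber {n} D
    with greatest n
           (λ m → anyDigraph? λ T → isOutBranching? D T ×-dec (leaves T ≟ m))
           (λ { m (T , _ , refl) → leaves≤n T })
  ... | inj₁ (m , (T , B , eq) , max) =
          m , (λ { (T′ , B′) → max _ (T′ , B′ , refl) }) , inj₁ ((T , B) , eq)
  ... | inj₂ none =
          0 , (λ { (T , B) → ⊥-elim (none _ (T , B , refl)) })
            , inj₂ ((λ { (T , B) → none _ (T , B , refl) }) , refl)

ℓₛ : Digraph n → ℕ
ℓₛ D = proj₁ (leafNumber D)

ℓₛ-isLeafNumber : (D : Digraph n) → IsLeafNumber D (ℓₛ D)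
ℓₛ-isLeafNumber D = proj₂ (leafNumber D)

------------------------------------------------------------------------
-- Existence of the pathwidth

bag≤bagsWidth : ∀ (Xs : Vec (Subset n) m) i →
  ∣ lookup Xs i ∣ ∸ 1 ≤ bagsWidth Xs
bag≤bagsWidth (X ∷ Xs) zero    = m≤m⊔n _ _
bag≤bagsWidth (X ∷ Xs) (suc i) = ≤-trans (bag≤bagsWidth Xs i) (m≤n⊔m _ _)

bagsWidth-lub : ∀ (Xs : Vec (Subset n) m) {b} → (∀ i → ∣ lookup Xs i ∣ ∸ 1 ≤ b) →
  bagsWidth Xs ≤ b
bagsWidth-lub []       h = z≤n
bagsWidth-lub (X ∷ Xs) h = ⊔-lub (h zero) (bagsWidth-lub Xs (h ∘ suc))

module _ (G : Graph n) where
  open Graph G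
  open PathDecomposition hiding (width)

  trivialDecomposition : PathDecomposition G
  trivialDecomposition = record
    { p        = 0
    ; bags     = ⊤ ∷ []
    ; covers   = λ _ → zero , ∈⊤
    ; edges    = λ _ _ _ → zero , ∈⊤ , ∈⊤
    ; interval = λ { _ {j = zero} _ _ _ _ → ∈⊤ }
    }

  -- A bag contained in its predecessor can be dropped.
  drop : (P : PathDecomposition G) {q : ℕ} → p P ≡ suc q →
         (∃[ i ] bag P (suc i) ⊆ bag P (inject₁ i)) →
         Σ (PathDecomposition G) λ P′ → p P′ ≡ q × width P′ ≤ width P
  drop P@record { p = suc q } refl (i , sub) = P′ , refl ,
    bagsWidth-lub (bags P′) λ j →
      subst (λ X → ∣ X ∣ ∸ 1 ≤ width P) (sym (look j)) (bag≤bagsWidth (bags P) (f j))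
    where
    f : Fin (suc q) → Fin (suc (suc q))
    f = punchIn (suc i)

    bs : Vec (Subset n) (suc q)
    bs = tabulate (bag P ∘ f)

    look : ∀ j → lookup bs j ≡ bag P (f j)
    look = lookup∘tabulate (bag P ∘ f)

    inject₁≢suc : ∀ {m} (i : Fin m) → suc i ≢ inject₁ i
    inject₁≢suc (suc i) eq = inject₁≢suc i (Fin.suc-injective eq)

    hit : ∀ k → suc i ≢ k → ∃[ j ] (bag P k ⊆ lookup bs j)
    hit k ne = punchOut ne ,
      subst (bag P k ⊆_) (sym (look _)) (subst (λ k′ → bag P k ⊆ bag P k′) (sym (Fin.punchIn-punchOut ne)) id)

    absorb : ∀ k → ∃[ j ] (bag P k ⊆ lookup bs j)
    absorb k with suc i Fin.≟ k
    ... | no ne    = hit k ne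
    ... | yes refl with hit (inject₁ i) (inject₁≢suc i)
    ...   | j , h = j , h ∘ sub

    P′ : PathDecomposition G
    P′ = record
      { p        = q
      ; bags     = bs
      ; covers   = λ v → let k , v∈ = covers P v ; j , h = absorb k in j , h v∈
      ; edges    = λ u v e → let k , u∈ , v∈ = edges P u v e ; j , h = absorb k
                             in j , h u∈ , h v∈
      ; interval = λ v {a} {b} {c} a≤b b≤c v∈a v∈c →
          subst (v ∈_) (sym (look b))
            (interval P v (Fin.punchIn-mono-≤ (suc i) a b a≤b)
                          (Fin.punchIn-mono-≤ (suc i) b c b≤c)
                          (subst (v ∈_) (look a) v∈a) (subst (v ∈_) (look c) v∈c))
      }

  ⊈⇒new : ∀ {X Y : Subset n} → ¬ (X ⊆ Y) → ∃[ v ] (v ∈ X × v ∉ Y)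
  ⊈⇒new {X} {Y} X⊈Y = decidable-stable (any? λ v → (v ∈? X) ×-dec ¬? (v ∈? Y))
    λ none → X⊈Y λ {v} v∈X → decidable-stable (v ∈? Y) λ v∉Y → none (v , v∈X , v∉Y)

  -- If nothing can be dropped, each bag after the first has a new vertex.
  irredundant : (P : PathDecomposition G) →
                ¬ (∃[ i ] bag P (suc i) ⊆ bag P (inject₁ i)) → p P ≤ n
  irredundant P irr = Fin.injective⇒≤ inj
    where
    new : ∀ i → ∃[ v ] (v ∈ bag P (suc i) × v ∉ bag P (inject₁ i))
    new i = ⊈⇒new λ sub → irr (i , sub)

    f : Fin (p P) → Fin n
    f = proj₁ ∘ new

    f-< : ∀ {i j} → i Fin.< j → f i ≢ f j
    f-< {i} {j} i<j eq = proj₂ (proj₂ (new j))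
      (interval P (f j) {suc i} {inject₁ j} {suc j}
        (≤-trans i<j (≤-reflexive (sym (Fin.toℕ-inject₁ j))))
        (≤-trans (≤-reflexive (Fin.toℕ-inject₁ j)) (n≤1+n _))
        (subst (_∈ bag P (suc i)) eq (proj₁ (proj₂ (new i))))
        (proj₁ (proj₂ (new j))))

    inj : ∀ {i j} → f i ≡ f j → i ≡ j
    inj {i} {j} eq with <-cmp (toℕ i) (toℕ j)
    ... | tri< lt _ _ = ⊥-elim (f-< lt eq)
    ... | tri≈ _ e _  = Fin.toℕ-injective e
    ... | tri> _ _ gt = ⊥-elim (f-< gt (sym eq))

  shorten : ∀ q (P : PathDecomposition G) → p P ≡ q →
            Σ (PathDecomposition G) λ P′ → p P′ ≤ n × width P′ ≤ width P
  shorten q P eq with any? (λ i → bag P (suc i) ⊆? bag P (inject₁ i))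
  ... | no irr = P , irredundant P irr , ≤-refl
  shorten (suc q) P eq | yes red =
    let P₁ , eq₁ , le₁ = drop P eq red
        P₂ , short , le₂ = shorten q P₁ eq₁
    in P₂ , short , ≤-trans le₂ le₁
  shorten zero record { p = zero } refl | yes (() , _)

  width≤? : ∀ w → Dec (∃ λ (P : PathDecomposition G) → width P ≤ w)
  width≤? w = map′ to from (≤-any? n λ q → anyVec? {m = suc q} anySubset? λ Xs →
      (all? λ v → any? λ i → v ∈? lookup Xs i)
    ×-dec (all? λ u → all? λ v → (u ~? v) →-dec
             any? λ i → (u ∈? lookup Xs i) ×-dec (v ∈? lookup Xs i))
    ×-dec (all? λ v → all? λ i → all? λ j → all? λ k →
             (i Fin.≤? j) →-dec ((j Fin.≤? k) →-dec
               ((v ∈? lookup Xs i) →-dec ((v ∈? lookup Xs k) →-dec (v ∈? lookup Xs j)))))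
    ×-dec (bagsWidth Xs ≤? w))
    where
    to = λ { (q , _ , Xs , c , e , t , le) → record
               { p = q ; bags = Xs ; covers = c ; edges = e
               ; interval = λ v {i} {j} {k} → t v i j k } , le }
    from = λ { (P , le) →
      let P′ , short , le′ = shorten (p P) P refl
      in p P′ , short , bags P′ , covers P′ , edges P′
       , (λ v i j k → interval P′ v {i} {j} {k}) , ≤-trans le′ le }

  least : ∀ b → (∃ λ (P : PathDecomposition G) → width P ≤ b) → ∃ (IsPathwidth G)
  least zero (P , le) = width P , (λ _ → ≤-trans le z≤n) , P , refl
  least (suc b) (P , le) with width≤? b
  ... | yes h = least b h
  ... | no ¬h = width P , (λ Q → ≤-trans le (≰⇒> λ Q≤b → ¬h (Q , Q≤b))) , P , refl

abstract
  pathwidth : (G : Graph n) → ∃ (IsPathwidth G)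
  pathwidth {n} G = least G (width P) (P , ≤-refl)
    where
    P : PathDecomposition G
    P = trivialDecomposition G

pw : Graph n → ℕ
pw G = proj₁ (pathwidth G)

pw-isPathwidth : (G : Graph n) → IsPathwidth G (pw G)
pw-isPathwidth G = proj₂ (pathwidth G)

{-# OPTIONS --safe #-}
-- Suppose ℓₛ(D) < k and let T be an out-branching whose number of leaves cannot be
-- increased by giving one vertex a new parent. Then an arc of D that is neither in T nor
-- directed from a vertex to one of its ancestors starts at a leaf or ends at a vertex with
-- a sibling; these at most 3 ℓₛ(D) vertices are put into every bag. For a vertex x, the
-- proper ancestors of x that receive an arc from the subtree at x, hung below that subtree,
-- become distinct leaves of an out-tree, so there are fewer than k of them; together with x
-- and its parent they separate the subtree at x from the rest. Sweep the vertices in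
-- preorder, visiting last the sibling with the most leaves below it. An ancestor of the
-- current vertex x can still have unvisited neighbours only through x itself or through
-- one of the at most log₂ k ancestors at which the path to x leaves towards a child that
-- is not the last, which gives O(k log k) vertices at a time.
module Submission where

open import Defs
open import Data.Bool.Base using (true; false)
open import Data.Empty using (⊥-elim)
open import Data.Fin.Base as Fin using (Fin; zero; suc; toℕ; fromℕ<)
open import Data.Fin.Properties as Fin using (any?; all?)
open import Data.Fin.Subset using (Subset; inside; outside; _∈_; _∉_; _⊆_; ∣_∣; _∪_; _-_; ⁅_⁆; ⊥)
open import Data.Fin.Subset.Properties
open import Data.List.Base using (length; filter; allFin)
import Data.List.Base as List
open import Data.List.Properties using (filter-none; filter-some)
open import Data.List.Membership.Propositional using (lose)
open import Data.List.Membership.Propositional.Properties using (∈-allFin)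
import Data.List.Relation.Unary.All as ListAll
open import Data.Nat using (ℕ; zero; suc; _+_; _*_; _∸_; _^_; _⊔_; _≤_; _<_; _≥_; z≤n; s≤s; _≟_; _≤?_; _<?_)
open import Data.Nat.Logarithm using (⌊log₂_⌋; ⌊log₂⌋-mono-≤; ⌊log₂[2^n]⌋≡n)
open import Data.Nat.Properties
open import Data.Product using (∃; ∃-syntax; _×_; _,_; proj₁; proj₂)
open import Data.Sum using (_⊎_; inj₁; inj₂)
import Data.Sum as Sum
open import Data.Vec.Base using (Vec; []; _∷_; last; lookup; tabulate; here; there)
open import Data.Vec.Properties using (lookup∘tabulate; lookup⇒[]=; []=⇒lookup)
open import Data.Vec.Relation.Unary.All using (All; []; _∷_)
open import Data.Vec.Relation.Unary.AllPairs using ([]; _∷_)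
open import Data.Vec.Relation.Unary.Linked using (Linked; _∷_)
open import Data.Vec.Relation.Unary.Unique.Propositional using (Unique)
open import Function.Base using (_∘_; id)
open import Level using (0ℓ)
open import Relation.Binary.Core using (Rel)
open import Relation.Binary.Definitions using (Decidable; tri<; tri≈; tri>)
open import Relation.Binary.Construct.Closure.ReflexiveTransitive using (Star; ε; _◅_; _◅◅_)
open import Relation.Binary.PropositionalEquality
open import Relation.Nullary using (Dec; yes; no; ¬_; does; contradiction)
open import Relation.Nullary.Decidable using (map′; ¬?; _×-dec_; _⊎-dec_; _→-dec_; decidable-stable; dec-true)
import Relation.Unary as U

private
  variable
    m n : ℕ

-- Finite subsets and counting.

subset : {P : Fin n → Set} → U.Decidable P → Subset n
subset P? = tabulate (does ∘ P?)

module _ {P : Fin n → Set} (P? : U.Decidable P) where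

  ∈-subset⁺ : ∀ {v} → P v → v ∈ subset P?
  ∈-subset⁺ {v} p =
    lookup⇒[]= v _ (trans (lookup∘tabulate _ v) (dec-true (P? v) p))

  ∈-subset⁻ : ∀ {v} → v ∈ subset P? → P v
  ∈-subset⁻ {v} v∈ with P? v in eq
  ... | yes p = p
  ... | no _ with () ← trans (sym ([]=⇒lookup v∈))
                             (trans (lookup∘tabulate _ v) (cong does eq))

∣subset∣≡filter : {P : Fin m → Set} (P? : U.Decidable P) (f : Fin n → Fin m) →
  ∣ subset (P? ∘ f) ∣ ≡ length (filter P? (List.tabulate f))
∣subset∣≡filter {n = zero}  P? f = refl
∣subset∣≡filter {n = suc n} P? f with does (P? (f zero))
... | true  = cong suc (∣subset∣≡filter P? (f ∘ suc))
... | false = ∣subset∣≡filter P? (f ∘ suc)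

∣p∪q∣≤∣p∣+∣q∣ : (p q : Subset n) → ∣ p ∪ q ∣ ≤ ∣ p ∣ + ∣ q ∣
∣p∪q∣≤∣p∣+∣q∣ []            []            = z≤n
∣p∪q∣≤∣p∣+∣q∣ (inside ∷ p)  (inside ∷ q)  =
  s≤s (≤-trans (∣p∪q∣≤∣p∣+∣q∣ p q) (+-monoʳ-≤ ∣ p ∣ (n≤1+n _)))
∣p∪q∣≤∣p∣+∣q∣ (inside ∷ p)  (outside ∷ q) = s≤s (∣p∪q∣≤∣p∣+∣q∣ p q)
∣p∪q∣≤∣p∣+∣q∣ (outside ∷ p) (inside ∷ q)  =
  ≤-trans (s≤s (∣p∪q∣≤∣p∣+∣q∣ p q)) (≤-reflexive (sym (+-suc _ _)))
∣p∪q∣≤∣p∣+∣q∣ (outside ∷ p) (outside ∷ q) = ∣p∪q∣≤∣p∣+∣q∣ p q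

disjoint⇒∣p∣+∣q∣≤∣p∪q∣ : (p q : Subset n) → (∀ {x} → x ∈ p → x ∉ q) →
                         ∣ p ∣ + ∣ q ∣ ≤ ∣ p ∪ q ∣
disjoint⇒∣p∣+∣q∣≤∣p∪q∣ []            []            dis = z≤n
disjoint⇒∣p∣+∣q∣≤∣p∪q∣ (inside ∷ p)  (inside ∷ q)  dis = contradiction here (dis here)
disjoint⇒∣p∣+∣q∣≤∣p∪q∣ (inside ∷ p)  (outside ∷ q) dis =
  s≤s (disjoint⇒∣p∣+∣q∣≤∣p∪q∣ p q λ x∈p x∈q → dis (there x∈p) (there x∈q))
disjoint⇒∣p∣+∣q∣≤∣p∪q∣ (outside ∷ p) (inside ∷ q)  dis =
  ≤-trans (≤-reflexive (+-suc _ _))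
    (s≤s (disjoint⇒∣p∣+∣q∣≤∣p∪q∣ p q λ x∈p x∈q → dis (there x∈p) (there x∈q)))
disjoint⇒∣p∣+∣q∣≤∣p∪q∣ (outside ∷ p) (outside ∷ q) dis =
  disjoint⇒∣p∣+∣q∣≤∣p∪q∣ p q λ x∈p x∈q → dis (there x∈p) (there x∈q)

-- Induction on `p`: the partner `y` of the first element is removed from `q`, and injectivity lets
-- every other element keep its partner. A relation takes the place of a map, so that a partner such
-- as a leaf below a vertex may come from an existence proof.
injective-relation⇒∣p∣≤∣q∣ : (p : Subset m) (q : Subset n) {R : Fin m → Fin n → Set} →
  (∀ {x} → x ∈ p → ∃ λ y → y ∈ q × R x y) →
  (∀ {x x′ y} → x ∈ p → x′ ∈ p → R x y → R x′ y → x ≡ x′) →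
  ∣ p ∣ ≤ ∣ q ∣
injective-relation⇒∣p∣≤∣q∣ []            q total inj = z≤n
injective-relation⇒∣p∣≤∣q∣ (outside ∷ p) q total inj =
  injective-relation⇒∣p∣≤∣q∣ p q (total ∘ there)
    λ x∈ x′∈ r r′ → Fin.suc-injective (inj (there x∈) (there x′∈) r r′)
injective-relation⇒∣p∣≤∣q∣ (inside ∷ p)  q {R} total inj with total here
... | y , y∈q , Ry = ≤-trans
  (s≤s (injective-relation⇒∣p∣≤∣q∣ p (q - y) {λ x → R (suc x)}
    (λ x∈p → let z , z∈q , Rz = total (there x∈p) in
      z , x∈p∧x≢y⇒x∈p-y z∈q (λ { refl → case-0≢suc (inj here (there x∈p) Ry Rz) }) , Rz)
    λ x∈ x′∈ r r′ → Fin.suc-injective (inj (there x∈) (there x′∈) r r′)))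
  (x∈p⇒∣p-x∣<∣p∣ y∈q)
  where
  case-0≢suc : ∀ {A : Set} {i : Fin m} → zero ≡ suc i → A
  case-0≢suc ()

bounded : (f : Fin n → ℕ) → ∃[ b ] (∀ v → f v ≤ b)
bounded {zero}  f = 0 , λ ()
bounded {suc n} f = let b , f≤b = bounded (f ∘ suc) in
  f zero ⊔ b , λ { zero → m≤m⊔n _ _ ; (suc v) → m≤n⇒m≤o⊔n _ (f≤b v) }

module _ {P : Fin n → Set} (P? : U.Decidable P) (f : Fin n → ℕ) where

  maximal : ∃ P → ∃ λ v → P v × (∀ u → P u → f u ≤ f v)
  maximal (w , Pw) with bounded f
  ... | b , f≤b with greatest b (λ m → any? λ v → P? v ×-dec (f v ≟ m))
                       (λ { _ (v , _ , refl) → f≤b v })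
  ...   | inj₁ (_ , (v , Pv , refl) , max) = v , Pv , λ u Pu → max _ (u , Pu , refl)
  ...   | inj₂ none = ⊥-elim (none _ (w , Pw , refl))

minimal : {P : ℕ → Set} → U.Decidable P → ∀ b → P b →
          ∃[ m ] (P m × (∀ j → P j → m ≤ j))
minimal P? b p with P? 0
... | yes p₀ = 0 , p₀ , λ _ _ → z≤n
minimal P? zero    p | no ¬p₀ = contradiction p ¬p₀
minimal P? (suc b) p | no ¬p₀ = let m , q , min = minimal (P? ∘ suc) b p in
  suc m , q , λ { zero p₀ → contradiction p₀ ¬p₀ ; (suc j) r → s≤s (min j r) }

-- Path decompositions from vertex orderings.

-- Vertices of Z lie in every bag; the others are swept in the order of σ, which
-- need not be injective nor have an initial segment of ℕ as its image.
module VertexSeparation (G : Graph n) (Z : Subset n) (σ : Fin n → ℕ) where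
  open Graph G

  -- Outside `Z`, a vertex is kept from its own time to the latest time of a vertex outside `Z` in
  -- its closed neighbourhood. As `t` grows, one bound weakens and the other strengthens, so these
  -- times form an interval.
  Active : ℕ → Fin n → Set
  Active t w = w ∈ Z ⊎ (σ w ≤ t × ∃ λ u → u ∉ Z × (w ≡ u ⊎ w ~ u) × t ≤ σ u)

  active? : ∀ t → U.Decidable (Active t)
  active? t w = (w ∈? Z) ⊎-dec ((σ w ≤? t) ×-dec any? λ u →
    ¬? (u ∈? Z) ×-dec ((w Fin.≟ u) ⊎-dec (w ~? u)) ×-dec (t ≤? σ u))

  lastTime : ℕ
  lastTime = proj₁ (bounded σ)

  bag : Fin (suc lastTime) → Subset n
  bag i = subset (active? (toℕ i))

  bags : Vec (Subset n) (suc lastTime)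
  bags = tabulate bag

  bag⁺ : ∀ i {w} → Active (toℕ i) w → w ∈ lookup bags i
  bag⁺ i a = subst (_ ∈_) (sym (lookup∘tabulate bag i)) (∈-subset⁺ (active? (toℕ i)) a)

  bag⁻ : ∀ i {w} → w ∈ lookup bags i → Active (toℕ i) w
  bag⁻ i w∈ = ∈-subset⁻ (active? (toℕ i)) (subst (_ ∈_) (lookup∘tabulate bag i) w∈)

  time : Fin n → Fin (suc lastTime)
  time v = fromℕ< (s≤s (proj₂ (bounded σ) v))

  at-time : ∀ {w} v → Active (σ v) w → w ∈ lookup bags (time v)
  at-time v a = bag⁺ (time v) (subst (λ t → Active t _) (sym (Fin.toℕ-fromℕ< _)) a)

  self : ∀ v → Active (σ v) v
  self v with v ∈? Z
  ... | yes v∈Z = inj₁ v∈Z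
  ... | no  v∉Z = inj₂ (≤-refl , v , v∉Z , inj₁ refl , ≤-refl)

  earlier : ∀ {u v} → u ~ v → v ∉ Z → σ u ≤ σ v → Active (σ v) u
  earlier {u} {v} u~v v∉Z le = inj₂ (le , v , v∉Z , inj₂ u~v , ≤-refl)

  edge : ∀ u v → u ~ v → ∃ λ i → u ∈ lookup bags i × v ∈ lookup bags i
  edge u v u~v with u ∈? Z | v ∈? Z
  ... | yes u∈Z | _       = time v , at-time v (inj₁ u∈Z) , at-time v (self v)
  ... | no _    | yes v∈Z = time u , at-time u (self u) , at-time u (inj₁ v∈Z)
  ... | no u∉Z  | no v∉Z with ≤-total (σ u) (σ v)
  ...   | inj₁ le = time v , at-time v (earlier u~v v∉Z le) , at-time v (self v)
  ...   | inj₂ le = time u , at-time u (self u) , at-time u (earlier (~-sym u~v) u∉Z le)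

  decomposition : PathDecomposition G
  decomposition = record
    { p        = lastTime
    ; bags     = bags
    ; covers   = λ v → time v , at-time v (self v)
    ; edges    = edge
    ; interval = λ v {i} {j} {k} i≤j j≤k v∈i v∈k →
        bag⁺ j (convex i≤j j≤k (bag⁻ i v∈i) (bag⁻ k v∈k))
    }
    where
    convex : ∀ {i j k v} → i ≤ j → j ≤ k → Active i v → Active k v → Active j v
    convex i≤j j≤k (inj₁ z) _ = inj₁ z
    convex i≤j j≤k (inj₂ _) (inj₁ z) = inj₁ z
    convex i≤j j≤k (inj₂ (σ≤i , _)) (inj₂ (_ , u , u∉Z , w-u , k≤σ)) =
      inj₂ (≤-trans σ≤i i≤j , u , u∉Z , w-u , ≤-trans j≤k k≤σ)

  -- At time `t` take a latest `x` with `σ x ≤ t`. Every `w` with `σ w ≤ t` has `σ w ≤ σ x`, so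
  -- separators at vertices also bound the bags at times that `σ` skips. Before the first vertex
  -- only `Z` is present.
  pw≤ : ∀ b → (∀ x → ∃ λ C → ∣ C ∣ ≤ b ×
                (∀ {w u} → w ∉ Z → u ∉ Z → w ≡ u ⊎ w ~ u →
                           σ w ≤ σ x → σ x ≤ σ u → w ∈ C)) →
        pw G ≤ ∣ Z ∣ + b
  pw≤ b separator = ≤-trans (proj₁ (pw-isPathwidth G) decomposition)
    (bagsWidth-lub bags λ i → ≤-trans (m∸n≤m _ 1) (small i))
    where
    within : ∀ (X C : Subset n) → ∣ C ∣ ≤ b → (∀ {w} → w ∈ X → w ∉ Z → w ∈ C) →
             ∣ X ∣ ≤ ∣ Z ∣ + b
    within X C ∣C∣≤b X∖Z⊆C = ≤-trans
      (p⊆q⇒∣p∣≤∣q∣ {p = X} {q = Z ∪ C} λ {w} w∈X → x∈p∪q⁺ (split w w∈X))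
      (≤-trans (∣p∪q∣≤∣p∣+∣q∣ Z C) (+-monoʳ-≤ ∣ Z ∣ ∣C∣≤b))
      where
      split : ∀ w → w ∈ X → w ∈ Z ⊎ w ∈ C
      split w w∈X with w ∈? Z
      ... | yes w∈Z = inj₁ w∈Z
      ... | no  w∉Z = inj₂ (X∖Z⊆C w∈X w∉Z)

    small : ∀ i → ∣ lookup bags i ∣ ≤ ∣ Z ∣ + b
    small i with any? (λ x → σ x ≤? toℕ i)
    ... | no none = within _ ⊥ (≤-trans (≤-reflexive (∣⊥∣≡0 n)) z≤n) λ w∈ w∉Z →
      Sum.[ ⊥-elim ∘ w∉Z , (λ { (σ≤ , _) → contradiction (_ , σ≤) none }) ] (bag⁻ i w∈)
    ... | yes some with maximal (λ x → σ x ≤? toℕ i) σ some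
    ...   | x , σx≤i , max with separator x
    ...     | C , ∣C∣≤b , h = within _ C ∣C∣≤b λ w∈ w∉Z →
      Sum.[ ⊥-elim ∘ w∉Z
          , (λ { (σ≤ , _ , u∉Z , w-u , i≤σ) →
                 h w∉Z u∉Z w-u (max _ σ≤) (≤-trans σx≤i i≤σ) }) ] (bag⁻ i w∈)

-- Spanning out-trees as parent maps, and breadth-first search.

-- `depth` rules out cycles and drives induction along paths to the root; `parent root` is
-- unconstrained.
record Branching {n} (R : Rel (Fin n) 0ℓ) : Set where
  field
    root       : Fin n
    parent     : Fin n → Fin n
    depth      : Fin n → ℕ
    depth-root : depth root ≡ 0
    depth-step : ∀ {v} → v ≢ root → depth v ≡ suc (depth (parent v))
    arc        : ∀ {v} → v ≢ root → R (parent v) v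

weaken : {R S : Rel (Fin n) 0ℓ} → (∀ {u v} → R u v → S u v) → Branching R → Branching S
weaken R⊆S B = record { Branching B ; arc = R⊆S ∘ Branching.arc B }

module BreadthFirst {R : Rel (Fin n) 0ℓ} (R? : Decidable R) (r : Fin n)
                    (reach : ∀ v → Star R r v) where

  Walk : ℕ → Fin n → Set
  Walk zero    v = r ≡ v
  Walk (suc m) v = ∃ λ u → Walk m u × R u v

  walk? : ∀ m → U.Decidable (Walk m)
  walk? zero    v = r Fin.≟ v
  walk? (suc m) v = any? λ u → walk? m u ×-dec R? u v

  extend : ∀ {m u v} → Walk m u → Star R u v → ∃ λ m′ → Walk m′ v
  extend w ε        = _ , w
  extend w (a ◅ as) = extend (_ , w , a) as

  shortest : ∀ v → ∃ λ m → Walk m v × (∀ j → Walk j v → m ≤ j)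
  shortest v = let m , w = extend refl (reach v) in minimal (λ m → walk? m v) m w

  dist : Fin n → ℕ
  dist v = proj₁ (shortest v)

  lastStop : ∀ m v → Walk m v → Fin n
  lastStop zero    v _       = v
  lastStop (suc m) v (u , _) = u

  prev : Fin n → Fin n
  prev v = lastStop (dist v) v (proj₁ (proj₂ (shortest v)))

  -- A shortest walk without its last arc is again shortest, since a shorter walk to the last stop
  -- could be extended by that arc.
  step : ∀ {v} m (w : Walk m v) → (∀ j → Walk j v → m ≤ j) → v ≢ r →
         m ≡ suc (dist (lastStop m v w)) × R (lastStop m v w) v
  step zero refl min v≢r = contradiction refl v≢r
  step (suc m) (u , w , a) min v≢r =
    ≤-antisym (min _ (u , proj₁ (proj₂ (shortest u)) , a))
              (s≤s (proj₂ (proj₂ (shortest u)) m w)) , a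

  prev-step : ∀ {v} → v ≢ r → dist v ≡ suc (dist (prev v)) × R (prev v) v
  prev-step {v} = let _ , w , min = shortest v in step _ w min

  branching : Branching R
  branching = record
    { root       = r
    ; parent     = prev
    ; depth      = dist
    ; depth-root = n≤0⇒n≡0 (proj₂ (proj₂ (shortest r)) 0 refl)
    ; depth-step = proj₁ ∘ prev-step
    ; arc        = proj₂ ∘ prev-step
    }

-- The ancestor order.

module Rooted {R : Rel (Fin n) 0ℓ} (B : Branching R) where
  open Branching B public

  path-induction : (P : Fin n → Set) → P root →
                   (∀ v → v ≢ root → P (parent v) → P v) → ∀ v → P v
  path-induction P base step v = go (depth v) v refl
    where
    go : ∀ m v → depth v ≡ m → P v
    go m v eq with v Fin.≟ root
    ... | yes refl = base
    go zero v eq | no v≢r with () ← trans (sym eq) (depth-step v≢r)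
    go (suc m) v eq | no v≢r =
      step v v≢r (go m (parent v) (suc-injective (trans (sym (depth-step v≢r)) eq)))

  module _ {A : Set} (base : A) (step : Fin n → A → A) where

    -- Recursion along the path to the root. Started with `depth v`, the counter runs out exactly at
    -- the root.
    foldAt : ℕ → Fin n → A
    foldAt zero    v = base
    foldAt (suc m) v = step v (foldAt m (parent v))

    path-fold : Fin n → A
    path-fold v = foldAt (depth v) v

    path-fold-root : path-fold root ≡ base
    path-fold-root rewrite depth-root = refl

    path-fold-step : ∀ {v} → v ≢ root → path-fold v ≡ step v (path-fold (parent v))
    path-fold-step {v} v≢r = cong (λ m → foldAt m v) (depth-step v≢r)

  infix 4 _≽_ _≽?_

  data _≽_ (x : Fin n) : Fin n → Set where
    here : x ≽ x
    down : ∀ {y} → y ≢ root → x ≽ parent y → x ≽ y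

  root≽ : ∀ v → root ≽ v
  root≽ = path-induction (root ≽_) here λ _ → down

  ≽root⇒≡ : ∀ {x} → x ≽ root → x ≡ root
  ≽root⇒≡ here         = refl
  ≽root⇒≡ (down r≢r _) = contradiction refl r≢r

  ≽-step⁻ : ∀ {x y} → x ≽ y → x ≡ y ⊎ (y ≢ root × x ≽ parent y)
  ≽-step⁻ here         = inj₁ refl
  ≽-step⁻ (down y≢r p) = inj₂ (y≢r , p)

  ≽-strict : ∀ {x y} → x ≽ y → x ≢ y → y ≢ root × x ≽ parent y
  ≽-strict here         x≢x = contradiction refl x≢x
  ≽-strict (down y≢r p) _   = y≢r , p

  _≽?_ : Decidable _≽_
  x ≽? y = path-induction (λ y → Dec (x ≽ y))
    (map′ (λ { refl → here }) ≽root⇒≡ (x Fin.≟ root))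
    (λ y y≢r x≽?p → map′ Sum.[ (λ { refl → here }) , down y≢r ] (Sum.map₂ proj₂ ∘ ≽-step⁻)
                       ((x Fin.≟ y) ⊎-dec x≽?p))
    y

  ≽-trans : ∀ {x y z} → x ≽ y → y ≽ z → x ≽ z
  ≽-trans p here         = p
  ≽-trans p (down z≢r q) = down z≢r (≽-trans p q)

  parent≽ : ∀ {v} → v ≢ root → parent v ≽ v
  parent≽ v≢r = down v≢r here

  comparable : ∀ {x y z} → x ≽ z → y ≽ z → x ≽ y ⊎ y ≽ x
  comparable here         q            = inj₂ q
  comparable p@(down _ _) here         = inj₁ p
  comparable (down _ p)   (down _ q)   = comparable p q

  parent-< : ∀ {v} → v ≢ root → depth (parent v) < depth v
  parent-< v≢r = ≤-reflexive (sym (depth-step v≢r))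

  ≽⇒depth≤ : ∀ {x y} → x ≽ y → depth x ≤ depth y
  ≽⇒depth≤ here         = ≤-refl
  ≽⇒depth≤ (down y≢r p) = ≤-trans (≽⇒depth≤ p) (<⇒≤ (parent-< y≢r))

  ≽-antisym : ∀ {x y} → x ≽ y → y ≽ x → x ≡ y
  ≽-antisym here         q = refl
  ≽-antisym (down y≢r p) q = contradiction
    (≤-trans (parent-< y≢r) (≤-trans (≽⇒depth≤ q) (≽⇒depth≤ p))) (n≮n _)

  parent⋡ : ∀ {v} → v ≢ root → ¬ v ≽ parent v
  parent⋡ v≢r v≽p = contradiction (≤-trans (parent-< v≢r) (≽⇒depth≤ v≽p)) (n≮n _)

  ≽-first : ∀ {x y} → x ≽ y → x ≡ y ⊎ (∃ λ c → c ≢ root × parent c ≡ x × c ≽ y)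
  ≽-first here = inj₁ refl
  ≽-first (down y≢r p) with ≽-first p
  ... | inj₁ refl                 = inj₂ (_ , y≢r , refl , here)
  ... | inj₂ (c , c≢r , eq , c≽p) = inj₂ (c , c≢r , eq , down y≢r c≽p)

  HasChild : Fin n → Set
  HasChild v = ∃ λ c → c ≢ root × parent c ≡ v

  Leaf : Fin n → Set
  Leaf v = ¬ HasChild v

  hasChild? : U.Decidable HasChild
  hasChild? v = any? λ c → ¬? (c Fin.≟ root) ×-dec (parent c Fin.≟ v)

  leaf? : U.Decidable Leaf
  leaf? v = ¬? (hasChild? v)

  leafSet : Subset n
  leafSet = subset leaf?

-- Parent maps give out-branchings.

module Realise (D : Digraph n) (B : Branching (Digraph._⟶_ D)) where
  open Rooted B

  Arc : Fin n → Fin n → Set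
  Arc u v = v ≢ root × parent v ≡ u

  arc? : ∀ u → U.Decidable (Arc u)
  arc? u v = ¬? (v Fin.≟ root) ×-dec (parent v Fin.≟ u)

  children : Fin n → Subset n
  children u = subset (arc? u)

  Arc-< : ∀ {u v} → Arc u v → depth u < depth v
  Arc-< (v≢r , refl) = parent-< v≢r

  T : Digraph n
  T = record
    { out      = tabulate children
    ; loopless = λ v v∈ → n≮n _ (Arc-< (∈-subset⁻ (arc? v)
                   (subst (v ∈_) (lookup∘tabulate children v) v∈)))
    }

  module T = Digraph T

  arc⁻ : ∀ {u v} → u T.⟶ v → Arc u v
  arc⁻ {u} {v} v∈ = ∈-subset⁻ (arc? u) (subst (v ∈_) (lookup∘tabulate children u) v∈)

  arc⁺ : ∀ {u v} → Arc u v → u T.⟶ v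
  arc⁺ {u} {v} a = subst (v ∈_) (sym (lookup∘tabulate children u)) (∈-subset⁺ (arc? u) a)

  open Graph (UN T) using (_~_; ~-sym)

  connected : Graph.Connected (UN T)
  connected u v = ascend u ◅◅ descend v
    where
    descend : ∀ v → Star _~_ root v
    descend = path-induction _ ε λ v v≢r p → p ◅◅ (inj₁ (arc⁺ (v≢r , refl)) ◅ ε)

    ascend : ∀ v → Star _~_ v root
    ascend = path-induction _ ε λ v v≢r p → inj₂ (arc⁺ (v≢r , refl)) ◅ p

  -- A walk that never turns straight back cannot turn upwards after a step down. That its
  -- last step goes down is recorded as: the parent of the last vertex is on the walk.
  downwards : ∀ {x y} (ys : Vec (Fin n) m) → Arc x y → Unique (x ∷ y ∷ ys) →
              Linked _~_ (y ∷ ys) →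
              depth y ≤ depth (last (y ∷ ys)) × ¬ All (parent (last (y ∷ ys)) ≢_) (x ∷ y ∷ ys)
  downwards []       (_ , refl) _ _ = ≤-refl , λ { (≢x ∷ _) → ≢x refl }
  downwards (z ∷ zs) xy ((_ ∷ x≢z ∷ _) ∷ uniq) (yz ∷ linked) with yz
  ... | inj₂ zy = contradiction (trans (sym (proj₂ xy)) (proj₂ (arc⁻ zy))) x≢z
  ... | inj₁ yz with downwards zs (arc⁻ yz) uniq linked
  ...   | le , back = ≤-trans (<⇒≤ (Arc-< (arc⁻ yz))) le , λ { (_ ∷ all) → back all }

  -- After an initial climb the first step down brings `downwards` into force; a walk that only
  -- climbs ends strictly higher.
  ends-up-or-down : ∀ {y z} (zs : Vec (Fin n) m) → Unique (y ∷ z ∷ zs) → Linked _~_ (y ∷ z ∷ zs) →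
                    depth (last (z ∷ zs)) < depth y
                    ⊎ ¬ All (parent (last (z ∷ zs)) ≢_) (y ∷ z ∷ zs)
  ends-up-or-down zs uniq (inj₁ yz ∷ linked) =
    inj₂ (proj₂ (downwards zs (arc⁻ yz) uniq linked))
  ends-up-or-down [] uniq (inj₂ zy ∷ linked) = inj₁ (Arc-< (arc⁻ zy))
  ends-up-or-down (_ ∷ zs) (_ ∷ uniq) (inj₂ zy ∷ linked) with ends-up-or-down zs uniq linked
  ... | inj₁ lt   = inj₁ (<-trans lt (Arc-< (arc⁻ zy)))
  ... | inj₂ back = inj₂ λ { (_ ∷ all) → back all }

  last-≢ : ∀ {x} (ys : Vec (Fin n) (suc m)) → All (x ≢_) ys → x ≢ last ys
  last-≢ (y ∷ [])     (x≢y ∷ _) = x≢y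
  last-≢ (y ∷ z ∷ ys) (_ ∷ all) = last-≢ (z ∷ ys) all

  -- The cases are the directions of the two edges at `c₀`. If both neighbours are parents of `c₀`,
  -- they coincide, against distinctness. If `c₀` is the parent of the last vertex and the walk from
  -- `c₁` ends downwards, that walk already contains `c₀`. In the remaining cases comparing depths
  -- around the cycle gives a contradiction.
  acyclic : ¬ Graph.Cycle (UN T)
  acyclic (_ , c₀ ∷ c₁ ∷ c₂ ∷ cs , c₀∉ ∷ c₁∉ ∷ uniq , zc₀ ∷ c₀c₁ ∷ linked) with zc₀ | c₀c₁
  ... | inj₁ a | inj₁ b = n≮n _ (≤-trans (Arc-< (arc⁻ a)) (≤-trans (<⇒≤ (Arc-< (arc⁻ b)))
          (proj₁ (downwards (c₂ ∷ cs) (arc⁻ b) (c₀∉ ∷ c₁∉ ∷ uniq) linked))))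
  ... | inj₁ a | inj₂ b =
          last-≢ (c₂ ∷ cs) c₁∉ (trans (sym (proj₂ (arc⁻ b))) (proj₂ (arc⁻ a)))
  ... | inj₂ a | b with ends-up-or-down cs (c₁∉ ∷ uniq) linked | b
  ...   | inj₂ back | _     = back (subst (λ p → All (p ≢_) _) (sym (proj₂ (arc⁻ a))) c₀∉)
  ...   | inj₁ lt | inj₂ b′ = n≮n _ (<-trans lt (<-trans (Arc-< (arc⁻ b′)) (Arc-< (arc⁻ a))))
  ...   | inj₁ lt | inj₁ b′ = n≮n _ (≤-trans lt
          (proj₁ (downwards (c₂ ∷ cs) (arc⁻ b′) (c₀∉ ∷ c₁∉ ∷ uniq) linked)))

  isOutBranching : IsOutBranching D T
  isOutBranching = record
    { subdigraph = λ u v a → from-parent (arc⁻ a)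
    ; oriented   = λ { u v (a , b) → <-asym (Arc-< (arc⁻ a)) (Arc-< (arc⁻ b)) }
    ; tree       = connected , acyclic
    ; root       = root
    ; root-in    = cong length (filter-none (T._⟶? root)
                     (ListAll.universal (λ u a → proj₁ (arc⁻ a) refl) (allFin n)))
    ; root-uniq  = λ v no-in → decidable-stable (v Fin.≟ root) λ v≢r →
        <⇒≢ (filter-some (T._⟶? v) (lose (∈-allFin (parent v)) (arc⁺ (v≢r , refl))))
            (sym no-in)
    }
    where
    from-parent : ∀ {u v} → Arc u v → Digraph._⟶_ D u v
    from-parent (v≢r , refl) = arc v≢r

  ∣leafSet∣≤leaves : ∣ leafSet ∣ ≤ leaves T
  ∣leafSet∣≤leaves = ≤-trans
    (p⊆q⇒∣p∣≤∣q∣ λ v∈ → ∈-subset⁺ (λ v → T.outDegree v ≟ 0) (no-out (∈-subset⁻ leaf? v∈)))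
    (≤-reflexive (∣subset∣≡filter (λ v → T.outDegree v ≟ 0) id))
    where
    no-out : ∀ {v} → Leaf v → T.outDegree v ≡ 0
    no-out {v} leaf = trans
      (cong ∣_∣ (Empty-unique λ { (c , c∈) → leaf (c , arc⁻ c∈) })) (∣⊥∣≡0 n)

  ∣leafSet∣≤ℓₛ : ∣ leafSet ∣ ≤ ℓₛ D
  ∣leafSet∣≤ℓₛ = ≤-trans ∣leafSet∣≤leaves (proj₁ (ℓₛ-isLeafNumber D) (T , isOutBranching))

-- Heavy paths and leaf counts.

-- Siblings are ordered by key, that is by the number of leaves below them; a light
-- vertex is one that is not the last of its siblings.
module HeavyPaths {R : Rel (Fin n) 0ℓ} (B : Branching R) where
  open Rooted B public

  leafBelow? : ∀ x → U.Decidable (λ t → Leaf t × x ≽ t)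
  leafBelow? x t = leaf? t ×-dec (x ≽? t)

  leavesBelow : Fin n → Subset n
  leavesBelow x = subset (leafBelow? x)

  #leaves : Fin n → ℕ
  #leaves x = ∣ leavesBelow x ∣

  #leaves-mono : ∀ {x y} → x ≽ y → #leaves y ≤ #leaves x
  #leaves-mono {x} {y} x≽y = p⊆q⇒∣p∣≤∣q∣ λ t∈ →
    let leaf , y≽t = ∈-subset⁻ (leafBelow? y) t∈
    in ∈-subset⁺ (leafBelow? x) (leaf , ≽-trans x≽y y≽t)

  -- A lexicographic order: since `toℕ c < n`, the vertex number only breaks ties between equal leaf
  -- counts, which makes `key` injective.
  key : Fin n → ℕ
  key c = #leaves c * n + toℕ c

  key≤ : ∀ c → key c ≤ n * n + n
  key≤ c = +-mono-≤ (*-monoˡ-≤ n (∣p∣≤n (leavesBelow c))) (<⇒≤ (Fin.toℕ<n c))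

  key≤⇒#leaves≤ : ∀ {c c′} → key c ≤ key c′ → #leaves c ≤ #leaves c′
  key≤⇒#leaves≤ {c} {c′} le = ≮⇒≥ λ lt → n≮n _ (begin-strict
    key c                      ≤⟨ le ⟩
    #leaves c′ * n + toℕ c′    <⟨ +-monoʳ-< (#leaves c′ * n) (Fin.toℕ<n c′) ⟩
    #leaves c′ * n + n         ≡⟨ +-comm _ n ⟩
    suc (#leaves c′) * n       ≤⟨ *-monoˡ-≤ n lt ⟩
    #leaves c * n              ≤⟨ m≤m+n _ _ ⟩
    key c                      ∎)
    where open ≤-Reasoning

  key-injective : ∀ {c c′} → key c ≡ key c′ → c ≡ c′
  key-injective {c} {c′} eq = Fin.toℕ-injective (+-cancelˡ-≡ (#leaves c * n) _ _
    (trans eq (cong (λ l → l * n + toℕ c′)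
      (≤-antisym (key≤⇒#leaves≤ {c′} {c} (≤-reflexive (sym eq)))
                 (key≤⇒#leaves≤ {c} {c′} (≤-reflexive eq))))))

  Light : Fin n → Set
  Light c = c ≢ root × ∃ λ c′ → c′ ≢ root × parent c′ ≡ parent c × key c < key c′

  light? : U.Decidable Light
  light? c = ¬? (c Fin.≟ root) ×-dec any? λ c′ →
    ¬? (c′ Fin.≟ root) ×-dec (parent c′ Fin.≟ parent c) ×-dec (key c <? key c′)

  heavy-max : ∀ {c c′} → c ≢ root → ¬ Light c → c′ ≢ root → parent c′ ≡ parent c → key c′ ≤ key c
  heavy-max c≢r ¬light c′≢r eq = ≮⇒≥ λ lt → ¬light (c≢r , _ , c′≢r , eq , lt)

  comparable-siblings : ∀ {c c′} → c′ ≢ root → parent c′ ≡ parent c → c ≢ root → c ≽ c′ → c ≡ c′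
  comparable-siblings c′≢r eq c≢r c≽c′ with ≽-step⁻ c≽c′
  ... | inj₁ c≡c′       = c≡c′
  ... | inj₂ (_ , c≽p′) = contradiction (subst (_ ≽_) eq c≽p′) (parent⋡ c≢r)

  -- A sibling of larger key has at least as many leaves below it, and the leaves below the two
  -- siblings are disjoint sets among those below the parent.
  light-halves : ∀ {c} → Light c → #leaves c + #leaves c ≤ #leaves (parent c)
  light-halves {c} (c≢r , c′ , c′≢r , eq , lt) = begin
    #leaves c + #leaves c                ≤⟨ +-monoʳ-≤ (#leaves c) (key≤⇒#leaves≤ {c} {c′} (<⇒≤ lt)) ⟩
    #leaves c + #leaves c′               ≤⟨ disjoint⇒∣p∣+∣q∣≤∣p∪q∣ _ _ disjoint ⟩
    ∣ leavesBelow c ∪ leavesBelow c′ ∣   ≤⟨ p⊆q⇒∣p∣≤∣q∣ below-parent ⟩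
    #leaves (parent c)                   ∎
    where
    open ≤-Reasoning
    distinct : c ≢ c′
    distinct c≡c′ = <⇒≢ lt (cong key c≡c′)
    disjoint : ∀ {t} → t ∈ leavesBelow c → t ∉ leavesBelow c′
    disjoint t∈ t∈′ with comparable (proj₂ (∈-subset⁻ (leafBelow? c) t∈))
                                    (proj₂ (∈-subset⁻ (leafBelow? c′) t∈′))
    ... | inj₁ c≽c′ = distinct (comparable-siblings c′≢r eq c≢r c≽c′)
    ... | inj₂ c′≽c = distinct (sym (comparable-siblings c≢r (sym eq) c′≢r c′≽c))
    below-parent : leavesBelow c ∪ leavesBelow c′ ⊆ leavesBelow (parent c)
    below-parent t∈ with x∈p∪q⁻ (leavesBelow c) (leavesBelow c′) t∈
    ... | inj₁ t∈c  = let leaf , c≽t = ∈-subset⁻ (leafBelow? c) t∈c in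
      ∈-subset⁺ (leafBelow? (parent c)) (leaf , ≽-trans (parent≽ c≢r) c≽t)
    ... | inj₂ t∈c′ = let leaf , c′≽t = ∈-subset⁻ (leafBelow? c′) t∈c′ in
      ∈-subset⁺ (leafBelow? (parent c))
        (leaf , ≽-trans (subst (_≽ c′) eq (parent≽ c′≢r)) c′≽t)

  maxDepth : ℕ
  maxDepth = proj₁ (bounded depth)

  depth≤maxDepth : ∀ v → depth v ≤ maxDepth
  depth≤maxDepth = proj₂ (bounded depth)

  infix 4 _⇓_

  -- The heavy path starting at `x`. Only the vertices strictly below `x` must not be light, so that
  -- a light vertex can start such a path.
  data _⇓_ (x : Fin n) : Fin n → Set where
    here : x ⇓ x
    down : ∀ {t} → t ≢ root → ¬ Light t → x ⇓ parent t → x ⇓ t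

  ⇓⇒≽ : ∀ {x t} → x ⇓ t → x ≽ t
  ⇓⇒≽ here           = here
  ⇓⇒≽ (down t≢r _ p) = down t≢r (⇓⇒≽ p)

  ⇓-prepend : ∀ {c t} → c ≢ root → ¬ Light c → c ⇓ t → parent c ⇓ t
  ⇓-prepend c≢r ¬light here           = down c≢r ¬light here
  ⇓-prepend c≢r ¬light (down t≢r h p) = down t≢r h (⇓-prepend c≢r ¬light p)

  -- Descend each time to the child of largest key, which is never light; `m` bounds the levels that
  -- remain.
  ⇓-leaf : ∀ v → ∃ λ t → Leaf t × v ⇓ t
  ⇓-leaf v = go maxDepth v (m≤n⇒m≤o+n (depth v) ≤-refl)
    where
    go : ∀ m v → maxDepth ≤ depth v + m → ∃ λ t → Leaf t × v ⇓ t
    go m v le with hasChild? v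
    ... | no leaf = v , leaf , here
    ... | yes child with maximal (λ c → ¬? (c Fin.≟ root) ×-dec (parent c Fin.≟ v)) key child
    go zero v le | yes _ | c , (c≢r , refl) , _ = ⊥-elim (n≮n _ (begin-strict
      maxDepth                 ≤⟨ le ⟩
      depth (parent c) + 0     ≡⟨ +-identityʳ _ ⟩
      depth (parent c)         <⟨ parent-< c≢r ⟩
      depth c                  ≤⟨ depth≤maxDepth c ⟩
      maxDepth                 ∎))
      where open ≤-Reasoning
    go (suc m) v le | yes _ | c , (c≢r , refl) , max
      with go m c (≤-trans le (≤-reflexive (trans (+-suc _ m) (cong (_+ m) (sym (depth-step c≢r))))))
    ... | t , leaf , c⇓t = t , leaf , ⇓-prepend c≢r
          (λ { (_ , c′ , c′≢r , eq , lt) → n≮n _ (≤-trans lt (max c′ (c′≢r , eq))) }) c⇓t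

  #leaves>0 : ∀ v → 1 ≤ #leaves v
  #leaves>0 v with ⇓-leaf v
  ... | t , leaf , v⇓t = ≤-trans (≤-reflexive (sym (∣⁅x⁆∣≡1 t)))
    (p⊆q⇒∣p∣≤∣q∣ λ t′∈ → subst (_∈ leavesBelow v) (sym (x∈⁅y⁆⇒x≡y t t′∈))
                           (∈-subset⁺ (leafBelow? v) (leaf , ⇓⇒≽ v⇓t)))

  #leaves≤leafSet : ∀ v → #leaves v ≤ ∣ leafSet ∣
  #leaves≤leafSet v = p⊆q⇒∣p∣≤∣q∣ λ t∈ → ∈-subset⁺ leaf? (proj₁ (∈-subset⁻ (leafBelow? v) t∈))

  -- Choose a leaf below each element; two elements above the same leaf are comparable, hence equal.
  antichain≤leaves : (A : Subset n) → (∀ {x y} → x ∈ A → y ∈ A → x ≽ y → x ≡ y) →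
                     ∣ A ∣ ≤ ∣ leafSet ∣
  antichain≤leaves A anti = injective-relation⇒∣p∣≤∣q∣ A leafSet {_≽_}
    (λ {x} _ → let t , leaf , x⇓t = ⇓-leaf x in t , ∈-subset⁺ leaf? leaf , ⇓⇒≽ x⇓t)
    λ x∈ y∈ x≽t y≽t → Sum.[ anti x∈ y∈ , sym ∘ anti y∈ x∈ ] (comparable x≽t y≽t)

  lightSet : Subset n
  lightSet = subset light?

  light-above : ∀ {x y t} → x ⇓ t → y ≽ t → Light y → y ≽ x
  light-above here              y≽x y-light = y≽x
  light-above (down _ ¬light p) y≽t y-light with ≽-step⁻ y≽t
  ... | inj₁ refl      = contradiction y-light ¬light
  ... | inj₂ (_ , y≽p) = light-above p y≽p y-light

  -- Each light vertex is sent to the end of its heavy path. A light vertex above that end is above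
  -- the start of the path, so two light vertices with the same end are above each other.
  ∣lightSet∣≤leaves : ∣ lightSet ∣ ≤ ∣ leafSet ∣
  ∣lightSet∣≤leaves = injective-relation⇒∣p∣≤∣q∣ lightSet leafSet {_⇓_}
    (λ {x} _ → let t , leaf , x⇓t = ⇓-leaf x in t , ∈-subset⁺ leaf? leaf , x⇓t)
    λ x∈ y∈ x⇓t y⇓t → ≽-antisym
      (light-above y⇓t (⇓⇒≽ x⇓t) (∈-subset⁻ light? x∈))
      (light-above x⇓t (⇓⇒≽ y⇓t) (∈-subset⁻ light? y∈))

  HasSibling : Fin n → Set
  HasSibling v = v ≢ root × ∃ λ c → c ≢ root × parent c ≡ parent v × c ≢ v

  HeavyWithSibling : Fin n → Set
  HeavyWithSibling v = v ≢ root × ¬ Light v × ∃ λ c → Light c × parent c ≡ parent v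

  heavyWithSibling? : U.Decidable HeavyWithSibling
  heavyWithSibling? v = ¬? (v Fin.≟ root) ×-dec ¬? (light? v) ×-dec any? λ c →
    light? c ×-dec (parent c Fin.≟ parent v)

  -- Each such vertex is sent to a light sibling; this is injective because only one of the siblings
  -- has the largest key.
  ∣heavyWithSibling∣≤leaves : ∣ subset heavyWithSibling? ∣ ≤ ∣ leafSet ∣
  ∣heavyWithSibling∣≤leaves = ≤-trans
    (injective-relation⇒∣p∣≤∣q∣ (subset heavyWithSibling?) lightSet {λ v c → parent c ≡ parent v}
      (λ v∈ → let _ , _ , c , light , eq = ∈-subset⁻ heavyWithSibling? v∈
              in c , ∈-subset⁺ light? light , eq)
      λ v∈ v′∈ eq eq′ →
        let v≢r , v-heavy , _ = ∈-subset⁻ heavyWithSibling? v∈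
            v′≢r , v′-heavy , _ = ∈-subset⁻ heavyWithSibling? v′∈
            same = trans (sym eq) eq′
        in key-injective (≤-antisym (heavy-max v′≢r v′-heavy v≢r same)
                                    (heavy-max v≢r v-heavy v′≢r (sym same))))
    ∣lightSet∣≤leaves

  -- The set put into every bag. Vertices with a sibling are split into light and heavy ones because
  -- each class is then no larger than the set of leaves, whence the factor 3.
  exceptional : Subset n
  exceptional = leafSet ∪ (lightSet ∪ subset heavyWithSibling?)

  leaf∈exceptional : ∀ {v} → Leaf v → v ∈ exceptional
  leaf∈exceptional leaf = x∈p∪q⁺ (inj₁ (∈-subset⁺ leaf? leaf))

  sibling∈exceptional : ∀ {v} → HasSibling v → v ∈ exceptional
  sibling∈exceptional {v} (v≢r , c , c≢r , eq , c≢v) = x∈p∪q⁺ (inj₂ (x∈p∪q⁺ light-or-heavy))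
    where
    light-or-heavy : v ∈ lightSet ⊎ v ∈ subset heavyWithSibling?
    light-or-heavy with light? v
    ... | yes light = inj₁ (∈-subset⁺ light? light)
    ... | no ¬light = inj₂ (∈-subset⁺ heavyWithSibling? (v≢r , ¬light , c , (c≢r , v , v≢r , sym eq ,
          ≤∧≢⇒< (heavy-max v≢r ¬light c≢r eq) (c≢v ∘ key-injective)) , eq))

  ∣exceptional∣≤3*leaves : ∣ exceptional ∣ ≤ 3 * ∣ leafSet ∣
  ∣exceptional∣≤3*leaves = begin
    ∣ exceptional ∣
      ≤⟨ ∣p∪q∣≤∣p∣+∣q∣ leafSet _ ⟩
    ∣ leafSet ∣ + ∣ lightSet ∪ subset heavyWithSibling? ∣
      ≤⟨ +-monoʳ-≤ ∣ leafSet ∣ (∣p∪q∣≤∣p∣+∣q∣ lightSet _) ⟩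
    ∣ leafSet ∣ + (∣ lightSet ∣ + ∣ subset heavyWithSibling? ∣)
      ≤⟨ +-monoʳ-≤ ∣ leafSet ∣ (+-mono-≤ ∣lightSet∣≤leaves ∣heavyWithSibling∣≤leaves) ⟩
    ∣ leafSet ∣ + (∣ leafSet ∣ + ∣ leafSet ∣)
      ≡⟨ cong (λ l → ∣ leafSet ∣ + (∣ leafSet ∣ + l)) (sym (+-identityʳ _)) ⟩
    3 * ∣ leafSet ∣ ∎
    where open ≤-Reasoning

-- A preorder numbering.

-- A preorder numbering in which siblings appear by increasing key: the subtree at v
-- is numbered within [σ v , τ v). The numbers have gaps: every child gets a slot of length
-- base ^ height, whatever the size of its subtree.
module Preorder {R : Rel (Fin n) 0ℓ} (B : Branching R) where
  open HeavyPaths B public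

  -- Slot 0 of a vertex is left to the vertex itself and a child `c` takes slot `suc (key c)`, so at
  -- most `2 + (n * n + n)` slots are needed by `key≤`.
  base : ℕ
  base = 2 + (n * n + n)

  height : Fin n → ℕ
  height v = maxDepth ∸ depth v

  height-parent : ∀ {v} → v ≢ root → height (parent v) ≡ suc (height v)
  height-parent {v} v≢r = begin
    maxDepth ∸ depth (parent v)                 ≡⟨⟩
    suc maxDepth ∸ suc (depth (parent v))       ≡⟨ cong (suc maxDepth ∸_) (sym (depth-step v≢r)) ⟩
    suc maxDepth ∸ depth v                      ≡⟨ +-∸-assoc 1 (depth≤maxDepth v) ⟩
    suc (height v)                              ∎
    where open ≡-Reasoning

  slot : Fin n → ℕ
  slot v = base ^ height v

  slot-parent : ∀ {v} → v ≢ root → slot (parent v) ≡ base * slot v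
  slot-parent v≢r = cong (base ^_) (height-parent v≢r)

  slot>0 : ∀ v → 0 < slot v
  slot>0 v = m^n>0 base (height v)

  σ : Fin n → ℕ
  σ = path-fold 0 (λ c s → s + suc (key c) * slot c)

  τ : Fin n → ℕ
  τ v = σ v + slot v

  σ-step : ∀ {v} → v ≢ root → σ v ≡ σ (parent v) + suc (key v) * slot v
  σ-step = path-fold-step 0 (λ c s → s + suc (key c) * slot c)

  σ<τ : ∀ v → σ v < τ v
  σ<τ v = m<m+n (σ v) (slot>0 v)

  σ-parent-< : ∀ {v} → v ≢ root → σ (parent v) < σ v
  σ-parent-< {v} v≢r = subst (σ (parent v) <_) (sym (σ-step v≢r))
    (m<m+n (σ (parent v)) (≤-trans (slot>0 v) (m≤m+n _ _)))

  τ-step : ∀ {v} → v ≢ root → τ v ≡ σ (parent v) + suc (suc (key v)) * slot v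
  τ-step {v} v≢r = begin
    σ v + slot v                                        ≡⟨ cong (_+ slot v) (σ-step v≢r) ⟩
    σ (parent v) + suc (key v) * slot v + slot v        ≡⟨ +-assoc (σ (parent v)) _ _ ⟩
    σ (parent v) + (suc (key v) * slot v + slot v)      ≡⟨ cong (σ (parent v) +_) (+-comm _ (slot v)) ⟩
    σ (parent v) + suc (suc (key v)) * slot v           ∎
    where open ≡-Reasoning

  τ-parent : ∀ {v} → v ≢ root → τ v ≤ τ (parent v)
  τ-parent {v} v≢r = begin
    τ v                                         ≡⟨ τ-step v≢r ⟩
    σ (parent v) + suc (suc (key v)) * slot v
      ≤⟨ +-monoʳ-≤ (σ (parent v)) (*-monoˡ-≤ (slot v) (s≤s (s≤s (key≤ v)))) ⟩
    σ (parent v) + base * slot v                ≡⟨ cong (σ (parent v) +_) (sym (slot-parent v≢r)) ⟩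
    τ (parent v)                                ∎
    where open ≤-Reasoning

  siblings-apart : ∀ {c c′} → c ≢ root → c′ ≢ root → parent c′ ≡ parent c →
                   key c < key c′ → τ c ≤ σ c′
  siblings-apart {c} {c′} c≢r c′≢r eq lt = begin
    τ c                                         ≡⟨ τ-step c≢r ⟩
    σ (parent c) + suc (suc (key c)) * slot c
      ≤⟨ +-monoʳ-≤ (σ (parent c)) (*-monoˡ-≤ (slot c) (s≤s lt)) ⟩
    σ (parent c) + suc (key c′) * slot c        ≡⟨ cong₂ (λ p s → σ p + suc (key c′) * s) (sym eq) same-slot ⟩
    σ (parent c′) + suc (key c′) * slot c′      ≡⟨ sym (σ-step c′≢r) ⟩
    σ c′                                        ∎
    where
    open ≤-Reasoning
    same-slot : slot c ≡ slot c′
    same-slot = cong (λ d → base ^ (maxDepth ∸ d))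
      (trans (depth-step c≢r) (trans (cong (suc ∘ depth) (sym eq)) (sym (depth-step c′≢r))))

  ≽⇒σ≤ : ∀ {x y} → x ≽ y → σ x ≤ σ y
  ≽⇒σ≤ here         = ≤-refl
  ≽⇒σ≤ (down y≢r p) = ≤-trans (≽⇒σ≤ p) (<⇒≤ (σ-parent-< y≢r))

  ≽⇒τ≥ : ∀ {x y} → x ≽ y → τ y ≤ τ x
  ≽⇒τ≥ here         = ≤-refl
  ≽⇒τ≥ (down y≢r p) = ≤-trans (τ-parent y≢r) (≽⇒τ≥ p)

  ≽∧σ≥⇒≡ : ∀ {x y} → x ≽ y → σ y ≤ σ x → x ≡ y
  ≽∧σ≥⇒≡ here         _  = refl
  ≽∧σ≥⇒≡ (down y≢r p) le =
    contradiction (≤-trans (σ-parent-< y≢r) (≤-trans le (≽⇒σ≤ p))) (n≮n _)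

  data Position (x y : Fin n) : Set where
    above  : x ≽ y → Position x y
    below  : y ≽ x → Position x y
    before : τ x ≤ σ y → Position x y
    after  : τ y ≤ σ x → Position x y

  -- Induction along the path to `x`: the position relative to the parent is inherited, unless `y`
  -- is below the parent; then the keys of the two children involved decide.
  position : ∀ x y → Position x y
  position = path-induction _ (λ y → above (root≽ y)) λ c c≢r ih y → child c c≢r y (ih y)
    where
    child : ∀ c → c ≢ root → ∀ y → Position (parent c) y → Position c y
    child c c≢r y (below y≽p) = below (≽-trans y≽p (parent≽ c≢r))
    child c c≢r y (before le) = before (≤-trans (τ-parent c≢r) le)
    child c c≢r y (after le)  = after (≤-trans le (<⇒≤ (σ-parent-< c≢r)))
    child c c≢r y (above p≽y) with ≽-first p≽y
    ... | inj₁ refl = below (parent≽ c≢r)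
    ... | inj₂ (c′ , c′≢r , eq , c′≽y) with <-cmp (key c) (key c′)
    ...   | tri< lt _ _ = before (≤-trans (siblings-apart c≢r c′≢r eq lt) (≽⇒σ≤ c′≽y))
    ...   | tri≈ _ e _  = above (subst (_≽ y) (sym (key-injective e)) c′≽y)
    ...   | tri> _ _ gt = after (≤-trans (≽⇒τ≥ c′≽y) (siblings-apart c′≢r c≢r (sym eq) gt))

-- Separators along the sweep.

module Separators {R : Rel (Fin n) 0ℓ} (B : Branching R) (bag : Fin n → Subset n) where
  open Preorder B public

  enlarge : Fin n → Subset n → Subset n
  enlarge c S with light? c
  ... | yes _ = S ∪ bag (parent c)
  ... | no _  = S

  lightBags : Fin n → Subset n
  lightBags = path-fold ⊥ enlarge

  -- Each light vertex on a path at least halves the number of leaves below.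
  ∣lightBags∣≤ : ∀ b → (∀ x → ∣ bag x ∣ ≤ b) → ∀ x →
    ∃ λ j → ∣ lightBags x ∣ ≤ j * b × 2 ^ j * #leaves x ≤ #leaves root
  ∣lightBags∣≤ b bag≤b = path-induction _
    (0 , ≤-reflexive (trans (cong ∣_∣ (path-fold-root ⊥ enlarge)) (∣⊥∣≡0 n))
       , ≤-reflexive (+-identityʳ _))
    λ c c≢r (j , le , halves) →
      let j′ , le′ , halves′ = child c c≢r j (lightBags (parent c)) le halves
      in j′ , subst (λ S → ∣ S ∣ ≤ j′ * b) (sym (path-fold-step ⊥ enlarge c≢r)) le′ , halves′
    where
    open ≤-Reasoning
    child : ∀ c → c ≢ root → ∀ j S → ∣ S ∣ ≤ j * b → 2 ^ j * #leaves (parent c) ≤ #leaves root →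
            ∃ λ j′ → ∣ enlarge c S ∣ ≤ j′ * b × 2 ^ j′ * #leaves c ≤ #leaves root
    child c c≢r j S le halves with light? c
    ... | no _ = j , le , ≤-trans (*-monoʳ-≤ (2 ^ j) (#leaves-mono (parent≽ c≢r))) halves
    ... | yes light = suc j ,
      (begin
        ∣ S ∪ bag (parent c) ∣         ≤⟨ ∣p∪q∣≤∣p∣+∣q∣ S _ ⟩
        ∣ S ∣ + ∣ bag (parent c) ∣     ≤⟨ +-mono-≤ le (bag≤b (parent c)) ⟩
        j * b + b                      ≡⟨ +-comm (j * b) b ⟩
        suc j * b                      ∎) ,
      (begin
        2 * 2 ^ j * #leaves c          ≡⟨ cong (_* #leaves c) (*-comm 2 (2 ^ j)) ⟩
        2 ^ j * 2 * #leaves c          ≡⟨ *-assoc (2 ^ j) 2 _ ⟩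
        2 ^ j * (2 * #leaves c)        ≡⟨ cong (λ l → 2 ^ j * (#leaves c + l)) (+-identityʳ _) ⟩
        2 ^ j * (#leaves c + #leaves c) ≤⟨ *-monoʳ-≤ (2 ^ j) (light-halves light) ⟩
        2 ^ j * #leaves (parent c)     ≤⟨ halves ⟩
        #leaves root                   ∎)

  -- At least one leaf remains below `x` after `j` halvings, so `2 ^ j` is at most the number of
  -- leaves.
  ∣lightBags∣≤log : ∀ b → (∀ x → ∣ bag x ∣ ≤ b) → ∀ x →
                    ∣ lightBags x ∣ ≤ ⌊log₂ ∣ leafSet ∣ ⌋ * b
  ∣lightBags∣≤log b bag≤b x with ∣lightBags∣≤ b bag≤b x
  ... | j , le , halves = ≤-trans le (*-monoˡ-≤ b (begin
    j                        ≡⟨ sym (⌊log₂[2^n]⌋≡n j) ⟩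
    ⌊log₂ 2 ^ j ⌋            ≤⟨ ⌊log₂⌋-mono-≤ power ⟩
    ⌊log₂ ∣ leafSet ∣ ⌋      ∎))
    where
    open ≤-Reasoning
    power : 2 ^ j ≤ ∣ leafSet ∣
    power = begin
      2 ^ j                  ≡⟨ sym (*-identityʳ _) ⟩
      2 ^ j * 1              ≤⟨ *-monoʳ-≤ (2 ^ j) (#leaves>0 x) ⟩
      2 ^ j * #leaves x      ≤⟨ halves ⟩
      #leaves root           ≤⟨ #leaves≤leafSet root ⟩
      ∣ leafSet ∣            ∎

  module _ {w u : Fin n} (w≽u : w ≽ u) (in-bag : ∀ {x} → w ≽ x → x ≽ u → w ∈ bag x) where

    -- Both `w` and `x` are above `u`, hence comparable; if `x` is the higher one, the numbering
    -- forces `x ≡ w`.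
    open-in-subtree : ∀ {x} → σ w ≤ σ x → x ≽ u → w ∈ bag x
    open-in-subtree σw≤σx x≽u with comparable w≽u x≽u
    ... | inj₁ w≽x = in-bag w≽x x≽u
    ... | inj₂ x≽w with refl ← ≽∧σ≥⇒≡ x≽w σw≤σx = in-bag here x≽u

    -- Once the numbering has passed below p into c without meeting u, which comes
    -- later, either u is outside the subtree at p or c is light.
    open-outside-subtree : ∀ x → σ w ≤ σ x → σ x ≤ σ u → ¬ x ≽ u → w ∈ lightBags x
    open-outside-subtree = path-induction _
      (λ _ _ root⋡u → contradiction (root≽ u) root⋡u)
      λ c c≢r ih σw≤σc σc≤σu c⋡u →
        subst (w ∈_) (sym (path-fold-step ⊥ enlarge c≢r)) (child c c≢r ih σw≤σc σc≤σu c⋡u)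
      where
      child : ∀ c → c ≢ root →
        (σ w ≤ σ (parent c) → σ (parent c) ≤ σ u → ¬ parent c ≽ u → w ∈ lightBags (parent c)) →
        σ w ≤ σ c → σ c ≤ σ u → ¬ c ≽ u → w ∈ enlarge c (lightBags (parent c))
      child c c≢r ih σw≤σc σc≤σu c⋡u = result
        where
        p = parent c

        τc≤σu : τ c ≤ σ u
        τc≤σu with position c u
        ... | above c≽u = contradiction c≽u c⋡u
        ... | before le = le
        ... | after le  = contradiction (≤-trans (σ<τ u) (≤-trans le σc≤σu)) (n≮n _)
        ... | below u≽c = contradiction (subst (c ≽_) (sym (≽∧σ≥⇒≡ u≽c σc≤σu)) here) c⋡u

        -- The interval of `w` starts no later than `σ c` and, containing that of `u`, ends after
        -- it. So `w` is above `c`, and `w ≡ c` would put `c` above `u`.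
        w≽p : w ≽ p
        w≽p with position c w
        ... | above c≽w = contradiction (≽-trans c≽w w≽u) c⋡u
        ... | below w≽c = proj₂ (≽-strict w≽c λ { refl → c⋡u w≽u })
        ... | before le = contradiction (≤-trans (σ<τ c) (≤-trans le σw≤σc)) (n≮n _)
        ... | after le  = contradiction
              (≤-trans (σ<τ u) (≤-trans (≽⇒τ≥ w≽u) (≤-trans le σc≤σu))) (n≮n _)

        σp≤σu : σ p ≤ σ u
        σp≤σu = ≤-trans (<⇒≤ (σ-parent-< c≢r)) σc≤σu

        light-if-below : p ≽ u → Light c
        light-if-below p≽u with ≽-first p≽u
        ... | inj₁ refl = contradiction (≤-trans (σ-parent-< c≢r) σc≤σu) (n≮n _)
        ... | inj₂ (c′ , c′≢r , eq , c′≽u) with <-cmp (key c) (key c′)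
        ...   | tri< lt _ _ = c≢r , c′ , c′≢r , eq , lt
        ...   | tri≈ _ e _  = contradiction (subst (_≽ u) (sym (key-injective e)) c′≽u) c⋡u
        ...   | tri> _ _ gt = contradiction (begin-strict
                  σ u      <⟨ σ<τ u ⟩
                  τ u      ≤⟨ ≽⇒τ≥ c′≽u ⟩
                  τ c′     ≤⟨ siblings-apart c′≢r c≢r (sym eq) gt ⟩
                  σ c      ≤⟨ σc≤σu ⟩
                  σ u      ∎) (n≮n _)
          where open ≤-Reasoning

        result : w ∈ enlarge c (lightBags p)
        result with light? c | p ≽? u
        ... | yes _     | yes p≽u = x∈p∪q⁺ (inj₂ (open-in-subtree (≽⇒σ≤ w≽p) p≽u))
        ... | yes _     | no p⋡u  = x∈p∪q⁺ (inj₁ (ih (≽⇒σ≤ w≽p) σp≤σu p⋡u))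
        ... | no ¬light | yes p≽u = contradiction (light-if-below p≽u) ¬light
        ... | no _      | no p⋡u  = ih (≽⇒σ≤ w≽p) σp≤σu p⋡u

    open-vertex : ∀ x → σ w ≤ σ x → σ x ≤ σ u → w ∈ lightBags x ∪ bag x
    open-vertex x σw≤σx σx≤σu with x ≽? u
    ... | yes x≽u = x∈p∪q⁺ (inj₂ (open-in-subtree σw≤σx x≽u))
    ... | no  x⋡u = x∈p∪q⁺ (inj₁ (open-outside-subtree x σw≤σx σx≤σu x⋡u))

-- Locally optimal branchings.

module _ {D : Digraph n} (B : Branching (Digraph._⟶_ D)) where
  open Digraph D using (_⟶_; _⟶?_)
  open Rooted B

  -- `¬ v ≽ a` keeps `a` reachable without the old arc into `v`, `HasChild a` means that no leaf is
  -- lost at `a`, and the last two conditions turn `parent v` into a leaf.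
  Improving : Fin n → Fin n → Set
  Improving v a = v ≢ root × a ⟶ v × ¬ v ≽ a × HasChild a × a ≢ parent v
                × (∀ c → c ≢ root → parent c ≡ parent v → c ≡ v)

  improving? : Decidable Improving
  improving? v a = ¬? (v Fin.≟ root) ×-dec (a ⟶? v) ×-dec ¬? (v ≽? a) ×-dec hasChild? a
    ×-dec ¬? (a Fin.≟ parent v)
    ×-dec all? λ c → ¬? (c Fin.≟ root) →-dec ((parent c Fin.≟ parent v) →-dec (c Fin.≟ v))

  LocallyOptimal : Set
  LocallyOptimal = ∀ v a → ¬ Improving v a

  -- Make a the parent of v: the old parent becomes a leaf and no leaf is lost.
  improve : ∀ {v a} → Improving v a →
            ∃ λ (B′ : Branching _⟶_) → ∣ leafSet ∣ < ∣ Rooted.leafSet B′ ∣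
  improve {v} {a} (v≢r , a⟶v , v⋡a , a-inner , a≢p , only-child) =
    weaken Switched⇒⟶ B′ , p⊂q⇒∣p∣<∣q∣ (leaves⊆ , parent v , p∈ , p∉)
    where
    Switched : Rel (Fin n) 0ℓ
    Switched x y = (y ≡ v × x ≡ a) ⊎ (y ≢ v × y ≢ root × x ≡ parent y)

    switched? : Decidable Switched
    switched? x y = ((y Fin.≟ v) ×-dec (x Fin.≟ a))
      ⊎-dec (¬? (y Fin.≟ v) ×-dec ¬? (y Fin.≟ root) ×-dec (x Fin.≟ parent y))

    Switched⇒⟶ : ∀ {x y} → Switched x y → x ⟶ y
    Switched⇒⟶ (inj₁ (refl , refl))           = a⟶v
    Switched⇒⟶ (inj₂ (_ , y≢r , refl)) = arc y≢r

    reach-outside : ∀ y → ¬ v ≽ y → Star Switched root y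
    reach-outside = path-induction _ (λ _ → ε) λ y y≢r ih v⋡y →
      ih (v⋡y ∘ down y≢r) ◅◅ (inj₂ ((λ { refl → v⋡y here }) , y≢r , refl) ◅ ε)

    reach : ∀ y → Star Switched root y
    reach = path-induction _ ε step
      where
      step : ∀ y → y ≢ root → Star Switched root (parent y) → Star Switched root y
      step y y≢r p with y Fin.≟ v
      ... | yes y≡v = reach-outside a v⋡a ◅◅ (inj₁ (y≡v , refl) ◅ ε)
      ... | no y≢v  = p ◅◅ (inj₂ (y≢v , y≢r , refl) ◅ ε)

    -- In `Switched` the root has no in-neighbour and every other vertex has one, so the search can
    -- only return the switched tree.
    B′ : Branching Switched
    B′ = BreadthFirst.branching switched? root reach

    module B′ = Rooted B′

    child-arc : ∀ {t} → B′.HasChild t → ∃ (Switched t)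
    child-arc (c , c≢r , refl) = c , B′.arc c≢r

    still-leaf : ∀ {t} → Leaf t → B′.Leaf t
    still-leaf leaf child with child-arc child
    ... | _ , inj₁ (_ , refl)          = leaf a-inner
    ... | c , inj₂ (_ , c≢r , refl) = leaf (c , c≢r , refl)

    new-leaf : B′.Leaf (parent v)
    new-leaf child with child-arc child
    ... | _ , inj₁ (_ , p≡a)            = a≢p (sym p≡a)
    ... | c , inj₂ (c≢v , c≢r , eq) = c≢v (only-child c c≢r (sym eq))

    leaves⊆ : leafSet ⊆ B′.leafSet
    leaves⊆ t∈ = ∈-subset⁺ B′.leaf? (still-leaf (∈-subset⁻ leaf? t∈))

    p∈ : parent v ∈ B′.leafSet
    p∈ = ∈-subset⁺ B′.leaf? new-leaf

    p∉ : parent v ∉ leafSet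
    p∉ p∈ = ∈-subset⁻ leaf? p∈ (v , v≢r , refl)

-- Every improvement gains a leaf and there are at most `n` leaves, so `n` rounds suffice.
optimise : {D : Digraph n} → Branching (Digraph._⟶_ D) → ∃ (LocallyOptimal {D = D})
optimise {n} {D} B = go n B (m≤n+m n _)
  where
  go : ∀ m (B : Branching (Digraph._⟶_ D)) → n ≤ ∣ Rooted.leafSet B ∣ + m → ∃ (LocallyOptimal {D = D})
  go m B le with any? (λ v → any? (improving? {D = D} B v))
  ... | no none = B , λ v a imp → none (v , a , imp)
  ... | yes (_ , _ , imp) with improve {D = D} B imp
  go zero B le | yes _ | B′ , lt = contradiction
    (≤-trans (s≤s (≤-trans le (≤-reflexive (+-identityʳ _)))) (≤-trans lt (∣p∣≤n (Rooted.leafSet B′)))) (n≮n n)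
  go (suc m) B le | yes _ | B′ , lt =
    go m B′ (≤-trans le (≤-trans (≤-reflexive (+-suc _ m)) (+-monoˡ-≤ m lt)))

-- Back arcs out of a subtree.

module BackArcs {D : Digraph n} (strong : StronglyConnected D)
                (B : Branching (Digraph._⟶_ D)) where
  open Digraph D using (_⟶_; _⟶?_)
  open Rooted B

  Head : Fin n → Fin n → Set
  Head x w = w ≢ x × w ≽ x × ∃ λ u → x ≽ u × u ⟶ w

  head? : ∀ x → U.Decidable (Head x)
  head? x w = ¬? (w Fin.≟ x) ×-dec (w ≽? x) ×-dec any? λ u → (x ≽? u) ×-dec (u ⟶? w)

  heads : Fin n → Subset n
  heads x = subset (head? x)

  -- The subtree at x together with the heads as pendant vertices is an out-tree,
  -- which extends to an out-branching in which the heads are incomparable.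
  ∣heads∣≤leaves : ∀ x → ∃ λ (B′ : Branching _⟶_) → ∣ heads x ∣ ≤ ∣ Rooted.leafSet B′ ∣
  ∣heads∣≤leaves x = weaken proj₁ B′ , B′.antichain≤leaves (heads x) λ w∈ w′∈ →
      incomparable (∈-subset⁻ (head? x) w∈) (∈-subset⁻ (head? x) w′∈)
    where
    -- Whatever tree the search from `x` returns, this restriction places the parents of heads, and
    -- of vertices below `x` other than `x` itself, in the subtree at `x`.
    Permitted : Rel (Fin n) 0ℓ
    Permitted a b = a ⟶ b × (x ≽ b ⊎ Head x b → x ≽ a)

    permitted? : Decidable Permitted
    permitted? a b = (a ⟶? b) ×-dec (((x ≽? b) ⊎-dec head? x b) →-dec (x ≽? a))

    reach-below : ∀ {y} → x ≽ y → Star Permitted x y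
    reach-below here         = ε
    reach-below (down y≢r p) = reach-below p ◅◅ ((arc y≢r , λ _ → p) ◅ ε)

    -- Whenever the given walk enters the subtree at `x` or a head, the part walked so far is
    -- replaced by a permitted walk inside that subtree, followed by the arc to the head if there is
    -- one.
    extend : ∀ {a b} → Star Permitted x a → Star _⟶_ a b → Star Permitted x b
    extend p ε = p
    extend p (_◅_ {j = b} a⟶b q) with x ≽? b | head? x b
    ... | yes x≽b | _ = extend (reach-below x≽b) q
    ... | no _    | yes (w≢x , w≽x , u , x≽u , u⟶b) =
      extend (reach-below x≽u ◅◅ ((u⟶b , λ _ → x≽u) ◅ ε)) q
    ... | no x⋡b  | no ¬head =
      extend (p ◅◅ ((a⟶b , λ s → contradiction s Sum.[ x⋡b , ¬head ]) ◅ ε)) q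

    B′ : Branching Permitted
    B′ = BreadthFirst.branching permitted? x λ v → extend ε (strong x v)

    module B′ = HeavyPaths B′

    stays-below : ∀ {z y} → z B′.≽ y → x ≽ y → x ≽ z
    stays-below B′.here         x≽y = x≽y
    stays-below (B′.down y≢x p) x≽y = stays-below p (proj₂ (B′.arc y≢x) (inj₁ x≽y))

    -- A head strictly above another one in `B′` would be above the parent of the latter and so lie
    -- in the subtree at `x`, but heads are proper ancestors of `x`.
    incomparable : ∀ {w w′} → Head x w → Head x w′ → w B′.≽ w′ → w ≡ w′
    incomparable _ _ B′.here = refl
    incomparable (w≢x , w≽x , _) head′ (B′.down w′≢x p) =
      contradiction (≽-antisym w≽x (stays-below p (proj₂ (B′.arc w′≢x) (inj₂ head′)))) w≢x

strong⇒branching : (D : Digraph n) → StronglyConnected D → Fin n → Branching (Digraph._⟶_ D)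
strong⇒branching D strong r = BreadthFirst.branching (Digraph._⟶?_ D) r (strong r)

-- The pathwidth bound in terms of the leaf number.

module PathwidthBound {D : Digraph n} (strong : StronglyConnected D)
                      (B : Branching (Digraph._⟶_ D)) (optimal : LocallyOptimal {D = D} B) where
  open Digraph D using (_⟶_; _⟶?_)
  open BackArcs {D = D} strong B using (heads; head?; ∣heads∣≤leaves)

  bag : Fin n → Subset n
  bag x = ⁅ x ⁆ ∪ (⁅ Branching.parent B x ⁆ ∪ heads x)

  open Separators B bag

  ∣bag∣≤ : ∀ x → ∣ bag x ∣ ≤ 2 + ℓₛ D
  ∣bag∣≤ x = begin
    ∣ bag x ∣                                          ≤⟨ ∣p∪q∣≤∣p∣+∣q∣ ⁅ x ⁆ _ ⟩
    ∣ ⁅ x ⁆ ∣ + ∣ ⁅ parent x ⁆ ∪ heads x ∣             ≤⟨ +-monoʳ-≤ ∣ ⁅ x ⁆ ∣ (∣p∪q∣≤∣p∣+∣q∣ ⁅ parent x ⁆ _) ⟩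
    ∣ ⁅ x ⁆ ∣ + (∣ ⁅ parent x ⁆ ∣ + ∣ heads x ∣)       ≡⟨ cong₂ (λ a b → a + (b + ∣ heads x ∣)) (∣⁅x⁆∣≡1 x) (∣⁅x⁆∣≡1 (parent x)) ⟩
    2 + ∣ heads x ∣                                    ≤⟨ +-monoʳ-≤ 2 heads≤ ⟩
    2 + ℓₛ D                                           ∎
    where
    open ≤-Reasoning
    heads≤ : ∣ heads x ∣ ≤ ℓₛ D
    heads≤ with ∣heads∣≤leaves x
    ... | B′ , le = ≤-trans le (Realise.∣leafSet∣≤ℓₛ D B′)

  data Link (w u : Fin n) : Set where
    same    : w ≡ u → Link w u
    tree    : u ≢ root → w ≡ parent u → Link w u
    backArc : u ⟶ w → w ≽ u → Link w u

  link⇒≽ : ∀ {w u} → Link w u → w ≽ u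
  link⇒≽ (same refl)     = here
  link⇒≽ (tree u≢r refl) = parent≽ u≢r
  link⇒≽ (backArc _ w≽u) = w≽u

  -- Supplies the hypothesis `in-bag` of `open-vertex`. For `w ≢ x`, a tree arc forces `x ≡ u`, so
  -- that `w` is the parent of `x`, and a back arc makes `w` a head of `x`.
  link⇒∈bag : ∀ {w u x} → Link w u → w ≽ x → x ≽ u → w ∈ bag x
  link⇒∈bag {w} {u} {x} link w≽x x≽u with w Fin.≟ x
  ... | yes refl = x∈p∪q⁺ (inj₁ (x∈⁅x⁆ x))
  ... | no w≢x = x∈p∪q⁺ (inj₂ (x∈p∪q⁺ (parent-or-head link)))
    where
    parent-or-head : Link w u → w ∈ ⁅ parent x ⁆ ⊎ w ∈ heads x
    parent-or-head (same refl) = contradiction (≽-antisym w≽x x≽u) w≢x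
    parent-or-head (backArc u⟶w _) = inj₂ (∈-subset⁺ (head? x) (w≢x , w≽x , u , x≽u , u⟶w))
    parent-or-head (tree u≢r refl) with ≽-step⁻ x≽u
    ... | inj₁ refl      = inj₁ (x∈⁅x⁆ (parent x))
    ... | inj₂ (_ , x≽w) = contradiction (≽-antisym w≽x x≽w) w≢x

  -- Otherwise, as `a` has a child and `v` has no sibling, making `a` the parent of `v` would be
  -- improving.
  unexceptional-arc : ∀ {a v} → a ∉ exceptional → v ∉ exceptional → v ≢ root → a ⟶ v →
                      v ≽ a ⊎ a ≡ parent v
  unexceptional-arc {a} {v} a∉ v∉ v≢r a⟶v with v ≽? a | a Fin.≟ parent v
  ... | yes v≽a | _       = inj₁ v≽a
  ... | no _    | yes a≡p = inj₂ a≡p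
  ... | no v⋡a  | no a≢p  = contradiction
    (v≢r , a⟶v , v⋡a , decidable-stable (hasChild? a) (a∉ ∘ leaf∈exceptional) , a≢p
    , λ c c≢r eq → decidable-stable (c Fin.≟ v) λ c≢v →
        v∉ (sibling∈exceptional (v≢r , c , c≢r , eq , c≢v)))
    (optimal v a)

  -- Arcs into the root are treated apart, as `unexceptional-arc` needs `v ≢ root`. Where `u` turns
  -- out to be above `w`, the numbering forces equality and `same` absorbs the case.
  link : ∀ {w u} → w ∉ exceptional → u ∉ exceptional → σ w ≤ σ u →
         w ≡ u ⊎ (w ⟶ u ⊎ u ⟶ w) → Link w u
  link w∉ u∉ le (inj₁ w≡u) = same w≡u
  link {w} {u} w∉ u∉ le (inj₂ (inj₁ w⟶u)) with u Fin.≟ root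
  ... | yes refl = same (sym (≽∧σ≥⇒≡ (root≽ w) le))
  ... | no u≢r with unexceptional-arc w∉ u∉ u≢r w⟶u
  ...   | inj₁ u≽w = same (sym (≽∧σ≥⇒≡ u≽w le))
  ...   | inj₂ w≡p = tree u≢r w≡p
  link {w} {u} w∉ u∉ le (inj₂ (inj₂ u⟶w)) with w Fin.≟ root
  ... | yes refl = backArc u⟶w (root≽ u)
  ... | no w≢r with unexceptional-arc u∉ w∉ w≢r u⟶w
  ...   | inj₁ w≽u  = backArc u⟶w w≽u
  ...   | inj₂ refl = contradiction (≤-trans (σ-parent-< w≢r) le) (n≮n _)

  -- The first summand counts `exceptional`; in the second, the logarithm counts the bags in
  -- `lightBags x` and the successor adds `bag x`.
  pw≤ : pw (UN D) ≤ 3 * ℓₛ D + suc ⌊log₂ ℓₛ D ⌋ * (2 + ℓₛ D)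
  pw≤ = ≤-trans
    (VertexSeparation.pw≤ (UN D) exceptional σ _ λ x →
      lightBags x ∪ bag x , small x , λ w∉ u∉ w-u σw≤σx σx≤σu →
        let l = link w∉ u∉ (≤-trans σw≤σx σx≤σu) w-u
        in open-vertex (link⇒≽ l) (link⇒∈bag l) x σw≤σx σx≤σu)
    (+-monoˡ-≤ _ (≤-trans ∣exceptional∣≤3*leaves (*-monoʳ-≤ 3 leaves≤)))
    where
    open ≤-Reasoning
    leaves≤ : ∣ leafSet ∣ ≤ ℓₛ D
    leaves≤ = Realise.∣leafSet∣≤ℓₛ D B

    small : ∀ x → ∣ lightBags x ∪ bag x ∣ ≤ suc ⌊log₂ ℓₛ D ⌋ * (2 + ℓₛ D)
    small x = begin
      ∣ lightBags x ∪ bag x ∣                     ≤⟨ ∣p∪q∣≤∣p∣+∣q∣ (lightBags x) _ ⟩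
      ∣ lightBags x ∣ + ∣ bag x ∣                 ≤⟨ +-mono-≤ (∣lightBags∣≤log _ ∣bag∣≤ x) (∣bag∣≤ x) ⟩
      ⌊log₂ ∣ leafSet ∣ ⌋ * (2 + ℓₛ D) + (2 + ℓₛ D) ≤⟨ +-monoˡ-≤ _ (*-monoˡ-≤ _ (⌊log₂⌋-mono-≤ leaves≤)) ⟩
      ⌊log₂ ℓₛ D ⌋ * (2 + ℓₛ D) + (2 + ℓₛ D)      ≡⟨ +-comm _ (2 + ℓₛ D) ⟩
      suc ⌊log₂ ℓₛ D ⌋ * (2 + ℓₛ D)               ∎

-- From the leaf number to `k log k`.

-- With `ℓₛ D < k` this gives `k ≥ 2`, so that the logarithm of `k` is at least 1.
0<ℓₛ : (D : Digraph n) → StronglyConnected D → Fin n → 0 < ℓₛ D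
0<ℓₛ D strong r = ≤-trans (#leaves>0 r) (≤-trans (#leaves≤leafSet r) (Realise.∣leafSet∣≤ℓₛ D B))
  where
  B = strong⇒branching D strong r
  open HeavyPaths B

pw-strong≤ : (D : Digraph n) → StronglyConnected D → Fin n →
             pw (UN D) ≤ 3 * ℓₛ D + suc ⌊log₂ ℓₛ D ⌋ * (2 + ℓₛ D)
pw-strong≤ D strong r with optimise {D = D} (strong⇒branching D strong r)
... | B , optimal = PathwidthBound.pw≤ {D = D} strong B optimal

pw-empty : (G : Graph 0) → pw G ≡ 0
pw-empty G = n≤0⇒n≡0 (proj₁ (pw-isPathwidth G) (trivialDecomposition G))

theorem8 : ∃[ C ] (∀ (k : ℕ) → 1 ≤ k → ∀ (n : ℕ) (D : Digraph n) → StronglyConnected D → ℓₛ D ≥ k ⊎ pw (UN D) ≤ C * (k * ⌊log₂ k ⌋))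
theorem8 = 7 , bound
  where
  open ≤-Reasoning

  -- Since `l ≥ 1`, each `k` is at most `k * l`. The constant 7 is 3 for `3 * k`, and 2 + 2 for the
  -- two summands of `suc l * (2 * k)`.
  numeric : ∀ k ℓ → 2 ≤ k → ℓ < k →
            3 * ℓ + suc ⌊log₂ ℓ ⌋ * (2 + ℓ) ≤ 7 * (k * ⌊log₂ k ⌋)
  numeric k ℓ 2≤k ℓ<k = begin
    3 * ℓ + suc ⌊log₂ ℓ ⌋ * (2 + ℓ)
      ≤⟨ +-mono-≤ (*-monoʳ-≤ 3 (<⇒≤ ℓ<k))
           (*-mono-≤ (s≤s (⌊log₂⌋-mono-≤ (<⇒≤ ℓ<k))) 2+ℓ≤2k) ⟩
    3 * k + suc l * (2 * k)
      ≤⟨ +-mono-≤ (*-monoʳ-≤ 3 k≤kl) (+-mono-≤ (*-monoʳ-≤ 2 k≤kl) (≤-reflexive swap-factors)) ⟩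
    3 * (k * l) + (2 * (k * l) + 2 * (k * l))
      ≡⟨ cong (3 * (k * l) +_) (sym (*-distribʳ-+ (k * l) 2 2)) ⟩
    3 * (k * l) + 4 * (k * l)
      ≡⟨ sym (*-distribʳ-+ (k * l) 3 4) ⟩
    7 * (k * l) ∎
    where
    l = ⌊log₂ k ⌋

    k≤kl : k ≤ k * l
    k≤kl = ≤-trans (≤-reflexive (sym (*-identityʳ k))) (*-monoʳ-≤ k (⌊log₂⌋-mono-≤ 2≤k))

    2+ℓ≤2k : 2 + ℓ ≤ 2 * k
    2+ℓ≤2k = begin
      2 + ℓ        ≡⟨ cong suc (sym (+-comm ℓ 1)) ⟩
      suc ℓ + 1    ≤⟨ +-mono-≤ ℓ<k (≤-trans (n≤1+n 1) 2≤k) ⟩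
      k + k        ≡⟨ cong (k +_) (sym (+-identityʳ k)) ⟩
      2 * k        ∎

    swap-factors : l * (2 * k) ≡ 2 * (k * l)
    swap-factors = trans (*-comm l (2 * k)) (*-assoc 2 k l)

  bound : ∀ k → 1 ≤ k → ∀ n (D : Digraph n) → StronglyConnected D →
          ℓₛ D ≥ k ⊎ pw (UN D) ≤ 7 * (k * ⌊log₂ k ⌋)
  -- The empty digraph has no out-branching, but its pathwidth is 0, which meets the bound even for
  -- `k = 1`, where the bound is 0.
  bound k 1≤k zero D strong = inj₂ (≤-trans (≤-reflexive (pw-empty (UN D))) z≤n)
  bound k 1≤k (suc n) D strong with k ≤? ℓₛ D
  ... | yes k≤ℓ = inj₁ k≤ℓ
  ... | no  k≰ℓ = inj₂ (≤-trans (pw-strong≤ D strong zero)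
    (numeric k (ℓₛ D) (≤-trans (s≤s (0<ℓₛ D strong zero)) (≰⇒> k≰ℓ)) (≰⇒> k≰ℓ)))
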